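{- Every cyclically $4$-edge-connected cubic graph $G$ with colouring defect $\operatorname{df}(G)=4$ admits a Berge cover, that is, there exist at most five perfect matchings of $G$ whose union contains every edge of $G$.
   Context: Graphs may have multiple edges and loops. A connected graph is cyclically $k$-edge-connected if the removal of fewer than $k$ edges cannot leave a subgraph with at least two components containing circuits. The colouring defect $\operatorname{df}(G)$ of a bridgeless cubic graph $G$ is the minimum, over all collections $\{M_1,M_2,M_3\}$ of three (not necessarily distinct) perfect matchings of $G$, of the number of edges belonging to none of $M_1,M_2,M_3$. -}

module Defs where

open import Data.Nat using (ℕ; _+_; _≤_; _<_; NonZero)
open import Data.Fin using (Fin)
open import Data.Fin.Properties using (_≟_)
open import Data.Fin.Subset using (Subset; _∈_; _⊆_; _∩_; _∪_; ∁; ⊤; ∣_∣; Nonempty)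
open import Data.List using (List; length)
open import Data.List.Relation.Unary.All using (All)
open import Data.List.Relation.Unary.Any using (Any)
open import Data.Product using (_×_; _,_; proj₁; proj₂; ∃-syntax)
open import Data.Sum using (_⊎_)
open import Data.Vec using (tabulate)
open import Relation.Binary.Construct.Closure.ReflexiveTransitive using (Star)
open import Relation.Binary.PropositionalEquality using (_≡_; _≢_)
open import Relation.Nullary using (¬_; does)

-- A finite multigraph, with parallel edges and loops allowed.  Each edge has
-- an unordered pair of ends; the order in which `ends` lists them plays no
-- role in any notion below.
record Graph : Set where
  field
    ∣V∣  : ℕ
    ∣E∣  : ℕ
    ends : Fin ∣E∣ → Fin ∣V∣ × Fin ∣V∣

  Vertex : Set
  Vertex = Fin ∣V∣

  Edge : Set
  Edge = Fin ∣E∣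

  EdgeSet : Set
  EdgeSet = Subset ∣E∣

module _ (G : Graph) where
  open Graph G

  firstEndAt secondEndAt : Vertex → EdgeSet
  firstEndAt  v = tabulate λ e → does (proj₁ (ends e) ≟ v)
  secondEndAt v = tabulate λ e → does (proj₂ (ends e) ≟ v)

  -- The degree of v in the spanning subgraph with edge set F.  Ends are
  -- counted, so a loop contributes 2.
  degree : EdgeSet → Vertex → ℕ
  degree F v = ∣ F ∩ firstEndAt v ∣ + ∣ F ∩ secondEndAt v ∣

  Cubic : Set
  Cubic = ∀ v → degree ⊤ v ≡ 3

  Adjacent : EdgeSet → Vertex → Vertex → Set
  Adjacent F u v = ∃[ e ] e ∈ F × (ends e ≡ (u , v) ⊎ ends e ≡ (v , u))

  -- u and v lie in the same component of the spanning subgraph (V , F).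
  Linked : EdgeSet → Vertex → Vertex → Set
  Linked F = Star (Adjacent F)

  Connected : Set
  Connected = NonZero ∣V∣ × (∀ u v → Linked ⊤ u v)

  -- A circuit is a connected 2-regular subgraph, given by its edge set; its
  -- vertices are those of nonzero degree.  A loop and a pair of parallel
  -- edges are circuits of length 1 and 2.
  IsCircuit : EdgeSet → Set
  IsCircuit C =
      Nonempty C
    × (∀ v → degree C v ≡ 0 ⊎ degree C v ≡ 2)
    × (∀ u v → degree C u ≢ 0 → degree C v ≢ 0 → Linked C u v)

  -- The component of u in (V , F) contains a circuit.
  ComponentHasCircuit : EdgeSet → Vertex → Set
  ComponentHasCircuit F u =
    ∃[ C ] IsCircuit C × C ⊆ F × (∀ v → degree C v ≢ 0 → Linked F u v)

  -- At least two components of (V , F) contain circuits; components are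
  -- represented by any of their vertices.
  TwoComponentsWithCircuits : EdgeSet → Set
  TwoComponentsWithCircuits F =
    ∃[ u ] ∃[ v ] ¬ Linked F u v
                × ComponentHasCircuit F u
                × ComponentHasCircuit F v

  CyclicallyEdgeConnected : ℕ → Set
  CyclicallyEdgeConnected k =
      Connected
    × (∀ (S : EdgeSet) → ∣ S ∣ < k → ¬ TwoComponentsWithCircuits (∁ S))

  -- Degree 1 at every vertex also excludes loops, which count 2.
  IsPerfectMatching : EdgeSet → Set
  IsPerfectMatching M = ∀ v → degree M v ≡ 1

  uncovered : EdgeSet → EdgeSet → EdgeSet → ℕ
  uncovered M₁ M₂ M₃ = ∣ ∁ (M₁ ∪ M₂ ∪ M₃) ∣

  -- df(G) = d: the minimum is attained with value d.  As a relation this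
  -- makes sense for every graph; it holds for no d exactly when G has no
  -- perfect matching, which does not occur for bridgeless cubic graphs.
  ColouringDefect : ℕ → Set
  ColouringDefect d =
      (∃[ M₁ ] ∃[ M₂ ] ∃[ M₃ ]
          IsPerfectMatching M₁ × IsPerfectMatching M₂ × IsPerfectMatching M₃
        × uncovered M₁ M₂ M₃ ≡ d)
    × (∀ M₁ M₂ M₃ →
          IsPerfectMatching M₁ → IsPerfectMatching M₂ → IsPerfectMatching M₃ →
          d ≤ uncovered M₁ M₂ M₃)

  BergeCover : List EdgeSet → Set
  BergeCover Ms =
      length Ms ≤ 5
    × All IsPerfectMatching Ms
    × (∀ (e : Edge) → Any (e ∈_) Ms)

{-# OPTIONS --safe #-}
-- Let M₁, M₂, M₃ be optimal, so that four edges are missed.  Call e covered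
-- c times an edge of excess c ∸ 1; at every vertex the missed edges and the
-- excess balance, so the total excess is 4 as well.
--
-- No edge lies in all three matchings: otherwise exchanging edges along a
-- short circuit in one Mᵢ would lower the defect, or there is a triangle,
-- against cyclic 4-edge-connectivity.  Hence the missed edges and the edges of
-- excess form disjoint alternating circuits, and counting shows that the four
-- missed edges a, b, c, d can be named so that an edge of excess joins a to b
-- and another joins c to d.
--
-- If e, h, f is a path avoided by some perfect matching P, then some perfect
-- matching contains e and f (apply this with P an Mᵢ that avoids h).  Otherwise
-- the Tutte–Berge theorem for the graph without the ends of e and f yields a
-- set A of vertices containing those ends and at least |A| − 2 disjoint odd
-- sets all of whose outgoing edges lead to A.  Give the edges of P weight 1
-- and the others weight 2: every vertex gets weight 5, every odd cut weighs at
-- least 5 by cyclic 4-edge-connectivity, and e, h, f lie inside A, so that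
-- 5|A| ≥ 5(|A| − 2) + 12, which is absurd.
--
-- Tutte–Berge comes from Gallai's lemma: if every vertex is missed by some
-- maximum matching, then "no maximum matching misses both u and v" is an
-- equivalence relation on distinct vertices.  No edge joins different classes
-- and a maximum matching misses at most one vertex of each class, so the class
-- of a missed vertex is odd.

module Submission where

open import Data.Product using (∃-syntax)
open import Defs

import Algebra.Properties.CommutativeSemigroup as CommutativeSemigroup
open import Data.Bool using (Bool; true; false; not; _∧_; _∨_; _xor_)
open import Data.Bool.Properties using (xor-identityʳ)
open import Data.Empty using (⊥; ⊥-elim)
open import Data.Fin using (Fin; zero; suc)
open import Data.Fin.Properties using (_≟_; any?; all?)
open import Data.Fin.Subset using (Subset; ∣_∣; _∩_; _∪_; ∁; ⊤; _∈_)
open import Data.Fin.Subset.Properties using (anySubset?; ∣p∣≤n)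
open import Data.List using (List; []; _∷_; length)
import Data.List.Membership.DecPropositional as DecMembership
import Data.List.Membership.Propositional as List
open import Data.List.Relation.Unary.All as All using (All; []; _∷_)
open import Data.List.Relation.Unary.All.Properties using (¬Any⇒All¬)
open import Data.List.Relation.Unary.AllPairs using ([]; _∷_)
open import Data.List.Relation.Unary.Any using (Any; here; there)
open import Data.List.Relation.Unary.Unique.Propositional using (Unique)
open import Data.Nat using (ℕ; zero; suc; _+_; _*_; _∸_; _≤_; _<_; z≤n; s≤s; _≤?_)
import Data.Nat as ℕ
open import Data.Nat.Properties hiding (_≟_)
open import Data.Product using (_×_; _,_; proj₁; proj₂)
open import Data.Sum using (_⊎_; inj₁; inj₂)
open import Data.Vec as Vec using (lookup; tabulate; _[_]≔_)
open import Data.Vec.Properties using (lookup∘tabulate; lookup∘update; lookup∘update′; lookup-zipWith; lookup-map; lookup-replicate; []=⇒lookup; lookup⇒[]=)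
open import Function using (_∘_)
open import Relation.Binary.Construct.Closure.ReflexiveTransitive as Star using (ε; _◅_; _◅◅_)
open import Relation.Binary.PropositionalEquality using (_≡_; _≢_; refl; sym; trans; cong; cong₂; subst; module ≡-Reasoning)
open import Relation.Nullary using (¬_; Dec; yes; no; does; contradiction)
open import Relation.Nullary.Decidable using (_×-dec_; _⊎-dec_; ¬?; decidable-stable; ¬¬-excluded-middle; dec-true; dec-false)
import Algebra.Properties.Semiring.Sum +-*-semiring as Semiring
open CommutativeSemigroup +-commutativeSemigroup using (interchange; x∙yz≈y∙xz; xy∙z≈xz∙y)
open CommutativeSemigroup *-commutativeSemigroup using () renaming (x∙yz≈y∙xz to *-swap)

-- Finite sums of natural numbers.

private variable
  n m : ℕ

-- Opaque, since unfolding through the algebraic bundles is very slow.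
opaque
  sum : (Fin n → ℕ) → ℕ
  sum = Semiring.sum

  sum-cong-≗ : {f g : Fin n → ℕ} → (∀ i → f i ≡ g i) → sum f ≡ sum g
  sum-cong-≗ = Semiring.sum-cong-≗

  ∑-distrib-+ : (f g : Fin n → ℕ) → sum (λ i → f i + g i) ≡ sum f + sum g
  ∑-distrib-+ = Semiring.∑-distrib-+

  ∑-comm : (f : Fin n → Fin m → ℕ) → sum (λ i → sum (f i)) ≡ sum (λ j → sum (λ i → f i j))
  ∑-comm = Semiring.∑-comm

  *-distribˡ-sum : ∀ x (f : Fin n → ℕ) → x * sum f ≡ sum (λ i → x * f i)
  *-distribˡ-sum = Semiring.*-distribˡ-sum

  sum-zero : (f : Fin n → ℕ) → (∀ i → f i ≡ 0) → sum f ≡ 0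
  sum-zero {zero}  f f≡0 = refl
  sum-zero {suc n} f f≡0 = cong₂ _+_ (f≡0 zero) (sum-zero (f ∘ suc) (f≡0 ∘ suc))

  sum-mono : {f g : Fin n → ℕ} → (∀ i → f i ≤ g i) → sum f ≤ sum g
  sum-mono {zero}  f≤g = z≤n
  sum-mono {suc n} f≤g = +-mono-≤ (f≤g zero) (sum-mono (f≤g ∘ suc))

  term≤sum : (f : Fin n → ℕ) → ∀ i → f i ≤ sum f
  term≤sum f zero    = m≤m+n _ _
  term≤sum f (suc i) = ≤-trans (term≤sum (f ∘ suc) i) (m≤n+m _ (f zero))

  sum-const : ∀ n c → sum {n} (λ _ → c) ≡ n * c
  sum-const zero    c = refl
  sum-const (suc n) c = cong (c +_) (sum-const n c)

  sum-suc : (f : Fin (suc n) → ℕ) → sum f ≡ f zero + sum (f ∘ suc)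
  sum-suc f = refl

-- Indicator values and the Kronecker delta.

bit : Bool → ℕ
bit true  = 1
bit false = 0

bit≤1 : ∀ b → bit b ≤ 1
bit≤1 true  = ≤-refl
bit≤1 false = z≤n

bit-not : ∀ b → bit b + bit (not b) ≡ 1
bit-not true  = refl
bit-not false = refl

bit≡1⇒true : ∀ {b} → 1 ≤ bit b → b ≡ true
bit≡1⇒true {true} _ = refl

bit-*-true : ∀ {b} x → b ≡ true → bit b * x ≡ x
bit-*-true x refl = *-identityˡ x

δ : Fin n → Fin n → ℕ
δ i j = bit (does (i ≟ j))

δ-refl : (i : Fin n) → δ i i ≡ 1
δ-refl i with i ≟ i
... | yes _   = refl
... | no  i≢i = contradiction refl i≢i

δ-≢ : {i j : Fin n} → i ≢ j → δ i j ≡ 0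
δ-≢ {i = i} {j} i≢j with i ≟ j
... | yes i≡j = contradiction i≡j i≢j
... | no  _   = refl

sum-δ : (i : Fin n) (f : Fin n → ℕ) → sum (λ j → δ i j * f j) ≡ f i
sum-δ zero    f = trans (sum-suc (λ j → δ zero j * f j)) (trans (cong₂ _+_ (*-identityˡ (f zero)) (sum-zero (λ j → δ zero (suc j) * f (suc j)) λ _ → refl)) (+-identityʳ (f zero)))
sum-δ (suc i) f = trans (sum-suc (λ j → δ (suc i) j * f j)) (trans (sum-cong-≗ (λ j → cong (_* f (suc j)) (δ-suc i j))) (sum-δ i (f ∘ suc)))
  where
  δ-suc : (i j : Fin n) → δ (suc i) (suc j) ≡ δ i j
  δ-suc i j with i ≟ j
  ... | yes _ = refl
  ... | no  _ = refl

-- Finite subsets and their characteristic functions.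

χ : Subset n → Fin n → ℕ
χ S i = bit (lookup S i)

-- Membership is a Boolean equation, so that it can be rewritten with directly and its negation
-- `_∌_` is again an equation.
_∋_ : Subset n → Fin n → Set
S ∋ i = lookup S i ≡ true

_∌_ : Subset n → Fin n → Set
S ∌ i = lookup S i ≡ false

infix 4 _∋_ _∌_

∋? : (S : Subset n) (i : Fin n) → S ∋ i ⊎ S ∌ i
∋? S i with lookup S i
... | true  = inj₁ refl
... | false = inj₂ refl

∋-∌ : ∀ {b} → b ≡ true → b ≡ false → ⊥
∋-∌ p q with trans (sym p) q
... | ()

∋-≢ : {S : Subset n} {i j : Fin n} → S ∋ i → S ∌ j → i ≢ j
∋-≢ p q refl = ∋-∌ p q

χ-∋ : ∀ {b} → b ≡ true → bit b ≡ 1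
χ-∋ = cong bit

χ-∌ : ∀ {b} → b ≡ false → bit b ≡ 0
χ-∌ = cong bit

χ≤1 : (S : Subset n) (i : Fin n) → χ S i ≤ 1
χ≤1 S i = bit≤1 (lookup S i)

χ-positive : {S : Subset n} {i : Fin n} → 1 ≤ χ S i → S ∋ i
χ-positive p = bit≡1⇒true p

∣∣≡sum : (S : Subset n) → ∣ S ∣ ≡ sum (χ S)
∣∣≡sum Vec.[]          = sym (sum-zero (χ Vec.[]) λ ())
∣∣≡sum (true  Vec.∷ S) = trans (cong suc (∣∣≡sum S)) (sym (sum-suc (χ (true Vec.∷ S))))
∣∣≡sum (false Vec.∷ S) = trans (∣∣≡sum S) (sym (sum-suc (χ (false Vec.∷ S))))

∣∣-mono : (S T : Subset n) → (∀ i → χ S i ≤ χ T i) → ∣ S ∣ ≤ ∣ T ∣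
∣∣-mono S T le = subst₂′ (sum-mono le)
  where
  subst₂′ : sum (χ S) ≤ sum (χ T) → ∣ S ∣ ≤ ∣ T ∣
  subst₂′ p rewrite ∣∣≡sum S | ∣∣≡sum T = p

_⊕_ _⊖_ : Subset n → Fin n → Subset n
S ⊕ i = S [ i ]≔ true
S ⊖ i = S [ i ]≔ false

infixl 7 _⊕_ _⊖_

⊕-∋ : (S : Subset n) (i : Fin n) → S ⊕ i ∋ i
⊕-∋ S i = lookup∘update i S true

⊖-∌ : (S : Subset n) (i : Fin n) → S ⊖ i ∌ i
⊖-∌ S i = lookup∘update i S false

⊕-other : (S : Subset n) {i j : Fin n} → j ≢ i → lookup (S ⊕ i) j ≡ lookup S j
⊕-other S j≢i = lookup∘update′ j≢i S true

⊖-other : (S : Subset n) {i j : Fin n} → j ≢ i → lookup (S ⊖ i) j ≡ lookup S j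
⊖-other S j≢i = lookup∘update′ j≢i S false

⊖-∋⁻ : (S : Subset n) {i j : Fin n} → S ⊖ i ∋ j → i ≢ j × S ∋ j
⊖-∋⁻ S {i} {j} p = i≢j , trans (sym (⊖-other S (i≢j ∘ sym))) p
  where
  i≢j : i ≢ j
  i≢j refl = ∋-∌ p (⊖-∌ S i)

⊖-∋⁺ : (S : Subset n) {i j : Fin n} → i ≢ j → S ∋ j → S ⊖ i ∋ j
⊖-∋⁺ S i≢j S∋j = trans (⊖-other S (i≢j ∘ sym)) S∋j

χ-⊕ : (S : Subset n) {i : Fin n} → S ∌ i → ∀ j → χ (S ⊕ i) j ≡ χ S j + δ i j
χ-⊕ S {i} S∌i j with i ≟ j
... | yes refl = trans (χ-∋ (⊕-∋ S i)) (sym (cong (_+ 1) (χ-∌ S∌i)))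
... | no  i≢j  = trans (cong bit (⊕-other S (i≢j ∘ sym))) (sym (+-identityʳ _))

χ-⊖ : (S : Subset n) {i : Fin n} → S ∋ i → ∀ j → χ S j ≡ χ (S ⊖ i) j + δ i j
χ-⊖ S {i} S∋i j with i ≟ j
... | yes refl = trans (χ-∋ S∋i) (sym (cong (_+ 1) (χ-∌ (⊖-∌ S i))))
... | no  i≢j  = trans (cong bit (sym (⊖-other S (i≢j ∘ sym)))) (sym (+-identityʳ _))

-- Covers both insertion and deletion of one element. With `f` constant it gives cardinalities, with
-- `f` an incidence function degrees, and with `f` a characteristic function the size of an overlap.
sum-χ+δ : (S T : Subset n) (i : Fin n) → (∀ j → χ S j ≡ χ T j + δ i j) →
          ∀ f → sum (λ j → χ S j * f j) ≡ sum (λ j → χ T j * f j) + f i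
sum-χ+δ S T i eq f = begin
  sum (λ j → χ S j * f j)                           ≡⟨ sum-cong-≗ (λ j → trans (cong (_* f j) (eq j)) (*-distribʳ-+ (f j) (χ T j) (δ i j))) ⟩
  sum (λ j → χ T j * f j + δ i j * f j)             ≡⟨ ∑-distrib-+ (λ j → χ T j * f j) (λ j → δ i j * f j) ⟩
  sum (λ j → χ T j * f j) + sum (λ j → δ i j * f j) ≡⟨ cong (sum (λ j → χ T j * f j) +_) (sum-δ i f) ⟩
  sum (λ j → χ T j * f j) + f i                     ∎
  where open ≡-Reasoning

∣∣≡weighted : (S : Subset n) → ∣ S ∣ ≡ sum (λ j → χ S j * 1)
∣∣≡weighted S = trans (∣∣≡sum S) (sum-cong-≗ {f = χ S} (λ j → sym (*-identityʳ (χ S j))))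

∣⊕∣ : (S : Subset n) {i : Fin n} → S ∌ i → ∣ S ⊕ i ∣ ≡ suc ∣ S ∣
∣⊕∣ S {i} S∌i = begin
  ∣ S ⊕ i ∣                   ≡⟨ ∣∣≡weighted (S ⊕ i) ⟩
  sum (λ j → χ (S ⊕ i) j * 1) ≡⟨ sum-χ+δ (S ⊕ i) S i (χ-⊕ S S∌i) (λ _ → 1) ⟩
  sum (λ j → χ S j * 1) + 1   ≡⟨ cong (_+ 1) (sym (∣∣≡weighted S)) ⟩
  ∣ S ∣ + 1                   ≡⟨ +-comm ∣ S ∣ 1 ⟩
  suc ∣ S ∣                   ∎
  where open ≡-Reasoning

∣⊖∣ : (S : Subset n) {i : Fin n} → S ∋ i → ∣ S ∣ ≡ suc ∣ S ⊖ i ∣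
∣⊖∣ S {i} S∋i = begin
  ∣ S ∣                           ≡⟨ ∣∣≡weighted S ⟩
  sum (λ j → χ S j * 1)           ≡⟨ sum-χ+δ S (S ⊖ i) i (χ-⊖ S S∋i) (λ _ → 1) ⟩
  sum (λ j → χ (S ⊖ i) j * 1) + 1 ≡⟨ cong (_+ 1) (sym (∣∣≡weighted (S ⊖ i))) ⟩
  ∣ S ⊖ i ∣ + 1                   ≡⟨ +-comm ∣ S ⊖ i ∣ 1 ⟩
  suc ∣ S ⊖ i ∣                   ∎
  where open ≡-Reasoning

∃-∋ : (S : Subset n) → 1 ≤ ∣ S ∣ → ∃[ i ] S ∋ i
∃-∋ (true  Vec.∷ S) _  = zero , refl
∃-∋ (false Vec.∷ S) le with ∃-∋ S le
... | i , S∋i = suc i , S∋i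

∋⇒1≤∣∣ : (S : Subset n) {i : Fin n} → S ∋ i → 1 ≤ ∣ S ∣
∋⇒1≤∣∣ S S∋i rewrite ∣⊖∣ S S∋i = s≤s z≤n

∁-lookup : (S : Subset n) (i : Fin n) → lookup (∁ S) i ≡ not (lookup S i)
∁-lookup S i = lookup-map i not S

∁-∋ : (S : Subset n) {i : Fin n} → S ∌ i → ∁ S ∋ i
∁-∋ S {i} S∌i = trans (∁-lookup S i) (cong not S∌i)

∁-∌ : (S : Subset n) {i : Fin n} → S ∋ i → ∁ S ∌ i
∁-∌ S {i} S∋i = trans (∁-lookup S i) (cong not S∋i)

∁-∋⁻¹ : (S : Subset n) {i : Fin n} → ∁ S ∋ i → S ∌ i
∁-∋⁻¹ S {i} p with ∋? S i
... | inj₂ S∌i = S∌i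
... | inj₁ S∋i = ⊥-elim (∋-∌ p (∁-∌ S S∋i))

χ-∁ : (S : Subset n) (i : Fin n) → χ S i + χ (∁ S) i ≡ 1
χ-∁ S i rewrite ∁-lookup S i = bit-not (lookup S i)

∣∣+∣∁∣ : (S : Subset n) → ∣ S ∣ + ∣ ∁ S ∣ ≡ n
∣∣+∣∁∣ {n} S = begin
  ∣ S ∣ + ∣ ∁ S ∣               ≡⟨ cong₂ _+_ (∣∣≡sum S) (∣∣≡sum (∁ S)) ⟩
  sum (χ S) + sum (χ (∁ S))     ≡⟨ sym (∑-distrib-+ (χ S) (χ (∁ S))) ⟩
  sum (λ i → χ S i + χ (∁ S) i) ≡⟨ sum-cong-≗ (χ-∁ S) ⟩
  sum {n} (λ _ → 1)             ≡⟨ trans (sum-const n 1) (*-identityʳ n) ⟩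
  n                             ∎
  where open ≡-Reasoning

-- Hill climbing: each improvement raises `μ` by at least one and `μ` is bounded by `b`, so
-- `b ∸ μ S₀` improvements suffice as fuel.
maximiser : {P : Subset n → Set} → (∀ S → Dec (P S)) → (μ : Subset n → ℕ) (b : ℕ) → (∀ S → P S → μ S ≤ b) →
            ∃[ S ] P S → ∃[ S ] P S × (∀ T → P T → μ T ≤ μ S)
maximiser {P = P} P? μ b bounded (S₀ , PS₀) = go (b ∸ μ S₀) S₀ PS₀ (≤-reflexive (sym (m∸n+n≡m (bounded S₀ PS₀))))
  where
  go : ∀ fuel S → P S → b ≤ fuel + μ S → ∃[ S ] P S × (∀ T → P T → μ T ≤ μ S)
  go fuel S PS le with anySubset? (λ T → P? T ×-dec (suc (μ S) ≤? μ T))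
  ... | no ¬larger = S , PS , λ T PT → ≮⇒≥ (λ S<T → ¬larger (T , PT , S<T))
  go zero       S PS le | yes (T , PT , S<T) = contradiction (≤-trans S<T (≤-trans (bounded T PT) le)) 1+n≰n
  go (suc fuel) S PS le | yes (T , PT , S<T) =
    go fuel T PT (≤-trans le (≤-trans (≤-reflexive (sym (+-suc fuel (μ S)))) (+-monoʳ-≤ fuel S<T)))

bit-∧ : ∀ a b → bit (a ∧ b) ≡ bit a * bit b
bit-∧ true  b = sym (*-identityˡ (bit b))
bit-∧ false b = refl

bit-xor-∧ : ∀ a b → bit a + bit b ≡ bit (a xor b) + 2 * bit (a ∧ b)
bit-xor-∧ true  true  = refl
bit-xor-∧ true  false = refl
bit-xor-∧ false true  = refl
bit-xor-∧ false false = refl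

*-distribˡ-+2* : ∀ w a b → w * (a + 2 * b) ≡ w * a + 2 * (w * b)
*-distribˡ-+2* w a b = trans (*-distribˡ-+ w a (2 * b)) (cong (w * a +_) (*-swap w 2 b))

*-shuffle : ∀ c w s t → c * (w * (s + t)) ≡ w * (s * c + t * c)
*-shuffle c w s t = trans (*-swap c w (s + t)) (cong (w *_) (trans (*-comm c (s + t)) (*-distribʳ-+ c s t)))

sum-regular : ∀ (X : Subset n) {f : Fin n → ℕ} {d} → (∀ v → X ∋ v → f v ≡ d) → sum (λ v → χ X v * f v) ≡ ∣ X ∣ * d
sum-regular X {f} {d} reg = begin
  sum (λ v → χ X v * f v)   ≡⟨ sum-cong-≗ pointwise ⟩
  sum (λ v → d * χ X v)     ≡⟨ sym (*-distribˡ-sum d (χ X)) ⟩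
  d * sum (χ X)             ≡⟨ cong (d *_) (sym (∣∣≡sum X)) ⟩
  d * ∣ X ∣                 ≡⟨ *-comm d ∣ X ∣ ⟩
  ∣ X ∣ * d                 ∎
  where
  open ≡-Reasoning
  pointwise : ∀ v → χ X v * f v ≡ d * χ X v
  pointwise v with ∋? X v
  ... | inj₁ X∋v rewrite X∋v = trans (*-identityˡ (f v)) (trans (reg v X∋v) (sym (*-identityʳ d)))
  ... | inj₂ X∌v rewrite X∌v = sym (*-zeroʳ d)

-- Incidences, the handshake identity and cuts.

module Incidence (G : Graph) where
  open Graph G

  src tgt : Edge → Vertex
  src e = proj₁ (ends e)
  tgt e = proj₂ (ends e)

  opaque
    -- The number of ends of `e` at `v`, hence 2 for a loop.
    inc : Edge → Vertex → ℕ
    inc e v = δ (src e) v + δ (tgt e) v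

    inc≡ : ∀ e v → inc e v ≡ δ (src e) v + δ (tgt e) v
    inc≡ e v = refl

  -- Degrees are weighted: `χ F` gives the degree in a subgraph, and other weights serve the
  -- counting of cuts, coverings and excess.
  deg : (Edge → ℕ) → Vertex → ℕ
  deg ω v = sum λ e → ω e * inc e v

  degree≡deg : ∀ F v → degree G F v ≡ deg (χ F) v
  degree≡deg F v = begin
    ∣ F ∩ firstEndAt G v ∣ + ∣ F ∩ secondEndAt G v ∣        ≡⟨ cong₂ _+_ (part (λ e → does (src e ≟ v))) (part (λ e → does (tgt e ≟ v))) ⟩
    sum (λ e → χ F e * δ (src e) v) + sum (λ e → χ F e * δ (tgt e) v)
                                                        ≡⟨ sym (∑-distrib-+ (λ e → χ F e * δ (src e) v) (λ e → χ F e * δ (tgt e) v)) ⟩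
    sum (λ e → χ F e * δ (src e) v + χ F e * δ (tgt e) v) ≡⟨ sum-cong-≗ (λ e → sym (trans (cong (χ F e *_) (inc≡ e v)) (*-distribˡ-+ (χ F e) (δ (src e) v) (δ (tgt e) v)))) ⟩
    deg (χ F) v                                         ∎
    where
    open ≡-Reasoning
    part : (b : Edge → Bool) → ∣ F ∩ tabulate b ∣ ≡ sum (λ e → χ F e * bit (b e))
    part b = trans (∣∣≡sum (F ∩ tabulate b)) (sum-cong-≗ λ e →
      trans (cong bit (trans (lookup-zipWith _∧_ e F (tabulate b)) (cong (lookup F e ∧_) (lookup∘tabulate b e))))
            (bit-∧ (lookup F e) (b e)))

  deg-cong : ∀ {ω ω′} → (∀ e → ω e ≡ ω′ e) → ∀ v → deg ω v ≡ deg ω′ v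
  deg-cong eq v = sum-cong-≗ λ e → cong (_* inc e v) (eq e)

  deg-+ : ∀ ω ω′ v → deg (λ e → ω e + ω′ e) v ≡ deg ω v + deg ω′ v
  deg-+ ω ω′ v = trans (sum-cong-≗ λ e → *-distribʳ-+ (inc e v) (ω e) (ω′ e)) (∑-distrib-+ (λ e → ω e * inc e v) (λ e → ω′ e * inc e v))

  -- Double counting of incidences. The vertex weights `c` make it apply to the whole graph (`c`
  -- constant) and to a vertex set (`c` its characteristic function).
  handshake : ∀ ω (c : Vertex → ℕ) →
              sum (λ v → c v * deg ω v) ≡ sum (λ e → ω e * (c (src e) + c (tgt e)))
  handshake ω c = begin
    sum (λ v → c v * deg ω v)                        ≡⟨ sum-cong-≗ (λ v → *-distribˡ-sum (c v) (λ e → ω e * inc e v)) ⟩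
    sum (λ v → sum (λ e → c v * (ω e * inc e v)))    ≡⟨ ∑-comm (λ v e → c v * (ω e * inc e v)) ⟩
    sum (λ e → sum (λ v → c v * (ω e * inc e v)))    ≡⟨ sum-cong-≗ (λ e → sum-cong-≗ λ v → trans (cong (λ i → c v * (ω e * i)) (inc≡ e v)) (*-shuffle (c v) (ω e) (δ (src e) v) (δ (tgt e) v))) ⟩
    sum (λ e → sum (λ v → ω e * (δ (src e) v * c v + δ (tgt e) v * c v)))
      ≡⟨ sum-cong-≗ (λ e → sym (*-distribˡ-sum (ω e) (λ v → δ (src e) v * c v + δ (tgt e) v * c v))) ⟩
    sum (λ e → ω e * sum (λ v → δ (src e) v * c v + δ (tgt e) v * c v))
      ≡⟨ sum-cong-≗ (λ e → cong (ω e *_) (trans (∑-distrib-+ (λ v → δ (src e) v * c v) (λ v → δ (tgt e) v * c v))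
                                                 (cong₂ _+_ (sum-δ (src e) c) (sum-δ (tgt e) c)))) ⟩
    sum (λ e → ω e * (c (src e) + c (tgt e)))        ∎
    where open ≡-Reasoning

  endsIn : Subset ∣V∣ → Edge → ℕ
  endsIn X e = χ X (src e) + χ X (tgt e)

  cut inner : Subset ∣V∣ → EdgeSet
  cut X   = tabulate λ e → lookup X (src e) xor lookup X (tgt e)
  inner X = tabulate λ e → lookup X (src e) ∧ lookup X (tgt e)

  cut-lookup : ∀ X e → lookup (cut X) e ≡ lookup X (src e) xor lookup X (tgt e)
  cut-lookup X e = lookup∘tabulate _ e

  inner-lookup : ∀ X e → lookup (inner X) e ≡ lookup X (src e) ∧ lookup X (tgt e)
  inner-lookup X e = lookup∘tabulate _ e

  endsIn≡ : ∀ X e → endsIn X e ≡ χ (cut X) e + 2 * χ (inner X) e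
  endsIn≡ X e rewrite cut-lookup X e | inner-lookup X e = bit-xor-∧ (lookup X (src e)) (lookup X (tgt e))

  weight : (Edge → ℕ) → EdgeSet → ℕ
  weight ω F = sum λ e → ω e * χ F e

  weight-1 : ∀ F → weight (λ _ → 1) F ≡ ∣ F ∣
  weight-1 F = trans (sum-cong-≗ {f = λ e → 1 * χ F e} {g = χ F} λ e → *-identityˡ (χ F e)) (sym (∣∣≡sum F))

  -- In the handshake identity for `χ X` a cut edge has one end in `X` and an inner edge two.
  volume : ∀ ω X → sum (λ v → χ X v * deg ω v) ≡ weight ω (cut X) + 2 * weight ω (inner X)
  volume ω X = begin
    sum (λ v → χ X v * deg ω v)   ≡⟨ handshake ω (χ X) ⟩
    sum (λ e → ω e * endsIn X e)  ≡⟨ sum-cong-≗ (λ e → trans (cong (ω e *_) (endsIn≡ X e)) (*-distribˡ-+2* (ω e) (χ (cut X) e) (χ (inner X) e))) ⟩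
    sum (λ e → ω e * χ (cut X) e + 2 * (ω e * χ (inner X) e))
      ≡⟨ ∑-distrib-+ (λ e → ω e * χ (cut X) e) (λ e → 2 * (ω e * χ (inner X) e)) ⟩
    weight ω (cut X) + sum (λ e → 2 * (ω e * χ (inner X) e))
      ≡⟨ cong (weight ω (cut X) +_) (sym (*-distribˡ-sum 2 (λ e → ω e * χ (inner X) e))) ⟩
    weight ω (cut X) + 2 * weight ω (inner X) ∎
    where open ≡-Reasoning

  regular-volume : ∀ ω X {d} → (∀ v → deg ω v ≡ d) → ∣ X ∣ * d ≡ weight ω (cut X) + 2 * weight ω (inner X)
  regular-volume ω X reg = trans (sym (sum-regular X λ v _ → reg v)) (volume ω X)

  deg-⊤ : ∀ v → degree G ⊤ v ≡ deg (λ _ → 1) v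
  deg-⊤ v = trans (degree≡deg ⊤ v) (deg-cong (λ e → cong bit (lookup-replicate e true)) v)

-- Auxiliary facts about finite index sets.

-- Allows linkedness to be decided for all vertices at once while a negative statement is being
-- proved.
¬¬-∀ : {P : Fin n → Set} → (∀ i → ¬ ¬ P i) → ¬ ¬ (∀ i → P i)
¬¬-∀ {zero}  _   ¬all = ¬all λ ()
¬¬-∀ {suc n} ¬¬P ¬all = ¬¬P zero λ p → ¬¬-∀ (¬¬P ∘ suc) λ ps → ¬all λ { zero → p ; (suc i) → ps i }

-- The gaps `g i ∸ f i` have sum at most 0, so each of them vanishes.
sum-squeeze : {f g : Fin n → ℕ} → (∀ i → f i ≤ g i) → sum g ≤ sum f → ∀ i → g i ≡ f i
sum-squeeze {f = f} {g} f≤g Σg≤Σf i = begin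
  g i              ≡⟨ gap i ⟩
  f i + (g i ∸ f i) ≡⟨ cong (f i +_) (n≤0⇒n≡0 (≤-trans (term≤sum (λ j → g j ∸ f j) i) Σgap≤0)) ⟩
  f i + 0          ≡⟨ +-identityʳ (f i) ⟩
  f i              ∎
  where
  open ≡-Reasoning
  gap : ∀ i → g i ≡ f i + (g i ∸ f i)
  gap i = sym (m+[n∸m]≡n (f≤g i))
  Σgap≤0 : sum (λ i → g i ∸ f i) ≤ 0
  Σgap≤0 = +-cancelˡ-≤ (sum f) _ 0 (≤-trans
    (≤-reflexive (trans (sym (∑-distrib-+ f (λ i → g i ∸ f i))) (sym (sum-cong-≗ gap))))
    (≤-trans Σg≤Σf (≤-reflexive (sym (+-identityʳ (sum f))))))

∋⇒∈ : {S : Subset n} {i : Fin n} → S ∋ i → i ∈ S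
∋⇒∈ {S = S} {i} = lookup⇒[]= i S

∈⇒∋ : {S : Subset n} {i : Fin n} → i ∈ S → S ∋ i
∈⇒∋ = []=⇒lookup

filter : {P : Fin n → Set} → (∀ i → Dec (P i)) → Subset n
filter P? = tabulate λ i → does (P? i)

filter⁺ : {P : Fin n → Set} (P? : ∀ i → Dec (P i)) {i : Fin n} → P i → filter P? ∋ i
filter⁺ P? {i} p = trans (lookup∘tabulate _ i) (dec-true (P? i) p)

filter⁻ : {P : Fin n → Set} (P? : ∀ i → Dec (P i)) {i : Fin n} → filter P? ∋ i → P i
filter⁻ P? {i} q with P? i | trans (sym (lookup∘tabulate (λ i → does (P? i)) i)) q
... | yes p | _ = p

filter-∌ : {P : Fin n → Set} (P? : ∀ i → Dec (P i)) {i : Fin n} → ¬ P i → filter P? ∌ i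
filter-∌ P? {i} ¬p = trans (lookup∘tabulate _ i) (dec-false (P? i) ¬p)

-- Circuits in subgraphs and small cuts of cubic graphs.

module Circuits (G : Graph) where
  open Graph G
  open Incidence G

  inc-src : ∀ e → 1 ≤ inc e (src e)
  inc-src e = ≤-trans (≤-trans (≤-reflexive (sym (δ-refl (src e)))) (m≤m+n _ _)) (≤-reflexive (sym (inc≡ e (src e))))

  inc-tgt : ∀ e → 1 ≤ inc e (tgt e)
  inc-tgt e = ≤-trans (≤-trans (≤-reflexive (sym (δ-refl (tgt e)))) (m≤n+m _ (δ (src e) (tgt e)))) (≤-reflexive (sym (inc≡ e (tgt e))))

  inc-src-or-tgt : ∀ e v → 1 ≤ inc e v → src e ≡ v ⊎ tgt e ≡ v
  inc-src-or-tgt e v le with src e ≟ v | tgt e ≟ v | ≤-trans le (≤-reflexive (inc≡ e v))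
  ... | yes p | _     | _  = inj₁ p
  ... | no  _ | yes p | _  = inj₂ p

  inc≤deg : ∀ F {e} v → F ∋ e → inc e v ≤ deg (χ F) v
  inc≤deg F {e} v F∋e = ≤-trans (≤-reflexive (sym (bit-*-true (inc e v) F∋e))) (term≤sum (λ e → χ F e * inc e v) e)

  deg-witness : ∀ F v → 1 ≤ deg (χ F) v → ∃[ e ] F ∋ e × 1 ≤ inc e v
  deg-witness F v le with any? (λ e → (1 ≤? χ F e) ×-dec (1 ≤? inc e v))
  ... | yes (e , p , q) = e , χ-positive {S = F} p , q
  ... | no  none        = contradiction (≤-trans le (≤-reflexive (sum-zero _ zeros))) λ ()
    where
    zeros : ∀ e → χ F e * inc e v ≡ 0
    zeros e with ∋? F e
    ... | inj₂ F∌e rewrite F∌e = refl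
    ... | inj₁ F∋e = trans (bit-*-true (inc e v) F∋e) (n≤0⇒n≡0 (≤-pred (≰⇒> λ le′ → none (e , ≤-reflexive (sym (χ-∋ F∋e)) , le′))))

  deg-⊖ : ∀ F {e} → F ∋ e → ∀ v → deg (χ F) v ≡ deg (χ (F ⊖ e)) v + inc e v
  deg-⊖ F {e} F∋e v = sum-χ+δ F (F ⊖ e) e (χ-⊖ F F∋e) (λ e → inc e v)

  deg-⊕ : ∀ F {e} → F ∌ e → ∀ v → deg (χ (F ⊕ e)) v ≡ deg (χ F) v + inc e v
  deg-⊕ F {e} F∌e v = sum-χ+δ (F ⊕ e) F e (χ-⊕ F F∌e) (λ e → inc e v)

  _Within_ : EdgeSet → Subset ∣V∣ → Set
  F Within X = ∀ e → F ∋ e → X ∋ src e × X ∋ tgt e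

  within-handshake : ∀ F X → F Within X → sum (λ v → χ X v * deg (χ F) v) ≡ ∣ F ∣ * 2
  within-handshake F X F⊆X = trans (handshake (χ F) (χ X))
    (sum-regular F λ e F∋e → cong₂ _+_ (χ-∋ (proj₁ (F⊆X e F∋e))) (χ-∋ (proj₂ (F⊆X e F∋e))))

  HasCircuit : EdgeSet → Set
  HasCircuit F = ∃[ C ] IsCircuit G C × (∀ e → C ∋ e → F ∋ e)

  linked-sym : ∀ {F u v} → Linked G F u v → Linked G F v u
  linked-sym = Star.reverse λ { (e , e∈F , inj₁ p) → e , e∈F , inj₂ p ; (e , e∈F , inj₂ p) → e , e∈F , inj₁ p }

  edge-linked : ∀ {F e} → F ∋ e → Linked G F (src e) (tgt e)
  edge-linked {F} {e} F∋e = (e , ∋⇒∈ F∋e , inj₁ refl) ◅ ε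

  -- Induction on the size of the subgraph, keeping at least as many edges as vertices. A vertex of
  -- degree at most 1 is deleted together with its edge, if any. If all degrees are at least 2, a
  -- surplus edge is deleted; without surplus the subgraph is 2-regular, and it is a circuit or has
  -- a smaller 2-regular component. The double negation arises because linkedness is not decided.
  circuit-exists : ∀ s X F → F Within X → ∣ X ∣ + ∣ F ∣ ≤ s → 1 ≤ ∣ X ∣ → ∣ X ∣ ≤ ∣ F ∣ → ¬ ¬ HasCircuit F
  circuit-exists zero X F _ size X≥1 _ = contradiction (≤-trans X≥1 (≤-trans (m≤m+n _ _) size)) λ ()
  circuit-exists (suc s) X F F⊆X size X≥1 X≤F with any? (λ v → (1 ≤? χ X v) ×-dec (deg (χ F) v ≤? 1))
  ... | yes (v , Xv , deg≤1) = low (m≤n⇒m<n∨m≡n deg≤1)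
    where
    X∋v : X ∋ v
    X∋v = χ-positive {S = X} Xv
    ∣X∣ : ∣ X ∣ ≡ suc ∣ X ⊖ v ∣
    ∣X∣ = ∣⊖∣ X X∋v
    remains : ∀ {u} → X ∋ u → v ≢ u → 1 ≤ ∣ X ⊖ v ∣
    remains X∋u v≢u = ∋⇒1≤∣∣ (X ⊖ v) (⊖-∋⁺ X v≢u X∋u)
    low : deg (χ F) v < 1 ⊎ deg (χ F) v ≡ 1 → ¬ ¬ HasCircuit F
    low (inj₁ deg<1) = circuit-exists s (X ⊖ v) F within (≤-pred (≤-trans (≤-reflexive (cong (_+ ∣ F ∣) (sym ∣X∣))) size))
        (let e , F∋e = ∃-∋ F (≤-trans X≥1 X≤F) in remains (proj₁ (F⊆X e F∋e)) (src≢ e F∋e))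
        (≤-trans (n≤1+n _) (≤-trans (≤-reflexive (sym ∣X∣)) X≤F))
      where
      no-inc : ∀ e → F ∋ e → ¬ 1 ≤ inc e v
      no-inc e F∋e le = contradiction (≤-trans le (≤-trans (inc≤deg F v F∋e) (≤-pred deg<1))) λ ()
      src≢ : ∀ e → F ∋ e → v ≢ src e
      src≢ e F∋e refl = no-inc e F∋e (inc-src e)
      tgt≢ : ∀ e → F ∋ e → v ≢ tgt e
      tgt≢ e F∋e refl = no-inc e F∋e (inc-tgt e)
      within : F Within (X ⊖ v)
      within e F∋e = ⊖-∋⁺ X (src≢ e F∋e) (proj₁ (F⊆X e F∋e)) , ⊖-∋⁺ X (tgt≢ e F∋e) (proj₂ (F⊆X e F∋e))
    low (inj₂ deg≡1) with deg-witness F v (≤-reflexive (sym deg≡1))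
    ... | e , F∋e , inc≥1 = λ none → circuit-exists s (X ⊖ v) (F ⊖ e) within
        (≤-trans (m≤n+m _ 1) (≤-pred (≤-trans (≤-reflexive (trans (sym (cong suc (+-suc _ _))) (sym (cong₂ _+_ ∣X∣ (∣⊖∣ F F∋e))))) size)))
        nonempty
        (≤-pred (≤-trans (≤-reflexive (sym ∣X∣)) (≤-trans X≤F (≤-reflexive (∣⊖∣ F F∋e)))))
        λ { (C , circuit , C⊆F) → none (C , circuit , λ f C∋f → proj₂ (⊖-∋⁻ F (C⊆F f C∋f))) }
      where
      total : deg (χ (F ⊖ e)) v + inc e v ≡ 1
      total = trans (sym (deg-⊖ F F∋e v)) deg≡1
      inc≤1 : inc e v ≤ 1
      inc≤1 = ≤-trans (m≤n+m _ (deg (χ (F ⊖ e)) v)) (≤-reflexive total)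
      no-inc : ∀ f → F ⊖ e ∋ f → ¬ 1 ≤ inc f v
      no-inc f F∋f le = contradiction (≤-trans (+-mono-≤ (≤-trans le (inc≤deg (F ⊖ e) v F∋f)) inc≥1) (≤-reflexive total)) λ { (s≤s ()) }
      within : (F ⊖ e) Within (X ⊖ v)
      within f F∋f = ⊖-∋⁺ X (λ { refl → no-inc f F∋f (inc-src f) }) (proj₁ (F⊆X f (proj₂ (⊖-∋⁻ F F∋f))))
                   , ⊖-∋⁺ X (λ { refl → no-inc f F∋f (inc-tgt f) }) (proj₂ (F⊆X f (proj₂ (⊖-∋⁻ F F∋f))))
      -- Since `e` has only one end at `v`, it is not a loop there and its other end survives.
      nonempty : 1 ≤ ∣ X ⊖ v ∣
      nonempty with v ≟ src e | v ≟ tgt e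
      ... | no  v≢ | _      = remains (proj₁ (F⊆X e F∋e)) v≢
      ... | yes _  | no  v≢ = remains (proj₂ (F⊆X e F∋e)) v≢
      ... | yes p  | yes q  = contradiction (≤-trans (≤-reflexive (sym (trans (inc≡ e v) (cong₂ _+_ (trans (cong (δ (src e)) p) (δ-refl (src e))) (trans (cong (δ (tgt e)) q) (δ-refl (tgt e))))))) inc≤1) λ { (s≤s ()) }
  ... | no  ¬low = high (m≤n⇒m<n∨m≡n X≤F)
    where
    deg≥2 : ∀ v → X ∋ v → 2 ≤ deg (χ F) v
    deg≥2 v X∋v = ≰⇒> λ deg≤1 → ¬low (v , ≤-reflexive (sym (χ-∋ X∋v)) , deg≤1)
    high : ∣ X ∣ < ∣ F ∣ ⊎ ∣ X ∣ ≡ ∣ F ∣ → ¬ ¬ HasCircuit F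
    high (inj₁ X<F) with ∃-∋ F (≤-trans X≥1 X≤F)
    ... | e , F∋e = λ none → circuit-exists s X (F ⊖ e) (λ f F∋f → F⊆X f (proj₂ (⊖-∋⁻ F F∋f)))
        (≤-pred (≤-trans (≤-reflexive (trans (sym (+-suc _ _)) (cong (∣ X ∣ +_) (sym (∣⊖∣ F F∋e))))) size)) X≥1
        (≤-pred (≤-trans X<F (≤-reflexive (∣⊖∣ F F∋e))))
        λ { (C , circuit , C⊆F) → none (C , circuit , λ f C∋f → proj₂ (⊖-∋⁻ F (C⊆F f C∋f))) }
    high (inj₂ X≡F) with ∃-∋ X X≥1
    ... | u , X∋u = λ none → ¬¬-∀ (λ v → ¬¬-excluded-middle {A = Linked G F u v}) (λ linked? → split linked? none)
      where
      -- The degrees are at least 2 on `X` and their sum is twice the number of edges, which equals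
      -- `∣ X ∣ * 2`.
      deg≡2 : ∀ v → X ∋ v → deg (χ F) v ≡ 2
      deg≡2 v X∋v = trans (sym (bit-*-true _ X∋v)) (trans (sum-squeeze le Σ≤ v) (bit-*-true 2 X∋v))
        where
        le : ∀ v → χ X v * 2 ≤ χ X v * deg (χ F) v
        le v with ∋? X v
        ... | inj₁ X∋v rewrite X∋v = +-monoˡ-≤ 0 (deg≥2 v X∋v)
        ... | inj₂ X∌v rewrite X∌v = z≤n
        Σ≤ : sum (λ v → χ X v * deg (χ F) v) ≤ sum (λ v → χ X v * 2)
        Σ≤ = ≤-reflexive (trans (within-handshake F X F⊆X) (trans (cong (_* 2) (sym X≡F)) (sym (sum-regular X λ _ _ → refl))))
      in-X : ∀ v → degree G F v ≢ 0 → X ∋ v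
      in-X v ≢0 with deg-witness F v (n≢0⇒n>0 (≢0 ∘ trans (degree≡deg F v)))
      ... | e , F∋e , inc≥1 with inc-src-or-tgt e v inc≥1
      ... | inj₁ refl = proj₁ (F⊆X e F∋e)
      ... | inj₂ refl = proj₂ (F⊆X e F∋e)
      degrees : ∀ v → degree G F v ≡ 0 ⊎ degree G F v ≡ 2
      degrees v with degree G F v ℕ.≟ 0
      ... | yes ≡0 = inj₁ ≡0
      ... | no  ≢0 = inj₂ (trans (degree≡deg F v) (deg≡2 v (in-X v ≢0)))
      split : (∀ v → Dec (Linked G F u v)) → ¬ ¬ HasCircuit F
      split linked? none with any? (λ v → (1 ≤? χ X v) ×-dec ¬? (linked? v))
      ... | no all-linked = none (F , ((e , ∋⇒∈ F∋e) , degrees , connected) , λ _ p → p)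
        where
        e   = proj₁ (∃-∋ F (≤-trans X≥1 X≤F))
        F∋e = proj₂ (∃-∋ F (≤-trans X≥1 X≤F))
        from-u : ∀ v → degree G F v ≢ 0 → Linked G F u v
        from-u v ≢0 = decidable-stable (linked? v) λ ¬l → all-linked (v , ≤-reflexive (sym (χ-∋ (in-X v ≢0))) , ¬l)
        connected : ∀ v w → degree G F v ≢ 0 → degree G F w ≢ 0 → Linked G F v w
        connected v w v≢0 w≢0 = linked-sym (from-u v v≢0) ◅◅ from-u w w≢0
      -- The subgraph is 2-regular but disconnected. The component of `u` is 2-regular again, hence
      -- has as many edges as vertices, and it is smaller because it omits `w`.
      ... | yes (w , Xw , ¬linked) = circuit-exists s X₁ F₁ within
          (≤-pred (≤-trans (+-mono-≤ X₁<X F₁≤F) size)) (∋⇒1≤∣∣ X₁ (filter⁺ in-X₁? (≤-reflexive (sym (χ-∋ X∋u)) , ε))) (≤-reflexive X₁≡F₁)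
          λ { (C , circuit , C⊆F₁) → none (C , circuit , λ f C∋f → χ-positive {S = F} (proj₁ (filter⁻ in-F₁? (C⊆F₁ f C∋f)))) }
        where
        in-X₁? : ∀ v → Dec (1 ≤ χ X v × Linked G F u v)
        in-X₁? v = (1 ≤? χ X v) ×-dec linked? v
        in-F₁? : ∀ e → Dec (1 ≤ χ F e × Linked G F u (src e))
        in-F₁? e = (1 ≤? χ F e) ×-dec linked? (src e)
        X₁ = filter in-X₁?
        F₁ = filter in-F₁?
        within : F₁ Within X₁
        within e F₁∋e = let Fe , l = filter⁻ in-F₁? F₁∋e
                            F∋e = χ-positive {S = F} Fe in
          filter⁺ in-X₁? (≤-reflexive (sym (χ-∋ (proj₁ (F⊆X e F∋e)))) , l) ,
          filter⁺ in-X₁? (≤-reflexive (sym (χ-∋ (proj₂ (F⊆X e F∋e)))) , l ◅◅ edge-linked F∋e)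
        -- Every edge of `F` at a vertex of the component belongs to the component, so degrees there
        -- do not change.
        same-degree : ∀ v → X₁ ∋ v → deg (χ F₁) v ≡ 2
        same-degree v X₁∋v = trans (sum-cong-≗ same) (deg≡2 v (χ-positive {S = X} (proj₁ X₁v)))
          where
          X₁v = filter⁻ in-X₁? X₁∋v
          same : ∀ e → χ F₁ e * inc e v ≡ χ F e * inc e v
          same e with ∋? F e | ∋? F₁ e | 1 ≤? inc e v
          ... | _ | _ | no ≱1 rewrite n≤0⇒n≡0 (≤-pred (≰⇒> ≱1)) = trans (*-zeroʳ (χ F₁ e)) (sym (*-zeroʳ (χ F e)))
          ... | inj₁ F∋e | inj₁ F₁∋e | _ = cong (_* inc e v) (trans (χ-∋ F₁∋e) (sym (χ-∋ F∋e)))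
          ... | inj₂ F∌e | inj₂ F₁∌e | _ = cong (_* inc e v) (trans (χ-∌ F₁∌e) (sym (χ-∌ F∌e)))
          ... | inj₂ F∌e | inj₁ F₁∋e | _ = ⊥-elim (∋-∌ (χ-positive {S = F} (proj₁ (filter⁻ in-F₁? F₁∋e))) F∌e)
          ... | inj₁ F∋e | inj₂ F₁∌e | yes inc≥1 = ⊥-elim (∋-∌ (filter⁺ in-F₁? (≤-reflexive (sym (χ-∋ F∋e)) , src-linked)) F₁∌e)
            where
            src-linked : Linked G F u (src e)
            src-linked with inc-src-or-tgt e v inc≥1
            ... | inj₁ refl = proj₂ X₁v
            ... | inj₂ refl = proj₂ X₁v ◅◅ linked-sym (edge-linked F∋e)
        X₁≡F₁ : ∣ X₁ ∣ ≡ ∣ F₁ ∣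
        X₁≡F₁ = *-cancelʳ-≡ ∣ X₁ ∣ ∣ F₁ ∣ 2 (trans (sym (sum-regular X₁ same-degree)) (within-handshake F₁ X₁ within))
        F₁≤F : ∣ F₁ ∣ ≤ ∣ F ∣
        F₁≤F = ∣∣-mono F₁ F le
          where
          le : ∀ e → χ F₁ e ≤ χ F e
          le e with ∋? F₁ e
          ... | inj₁ F₁∋e = ≤-trans (χ≤1 F₁ e) (proj₁ (filter⁻ in-F₁? F₁∋e))
          ... | inj₂ F₁∌e rewrite F₁∌e = z≤n
        X₁<X : ∣ X₁ ∣ < ∣ X ∣
        X₁<X = ≤-trans (s≤s (∣∣-mono X₁ (X ⊖ w) le)) (≤-reflexive (sym (∣⊖∣ X X∋w)))
          where
          X∋w : X ∋ w
          X∋w = χ-positive {S = X} Xw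
          le : ∀ v → χ X₁ v ≤ χ (X ⊖ w) v
          le v with ∋? X₁ v
          ... | inj₂ X₁∌v rewrite X₁∌v = z≤n
          ... | inj₁ X₁∋v = ≤-trans (χ≤1 X₁ v) (≤-reflexive (sym (χ-∋ (⊖-∋⁺ X (λ { refl → ¬linked (proj₂ X₁v) }) (χ-positive {S = X} (proj₁ X₁v))))))
            where X₁v = filter⁻ in-X₁? X₁∋v

  linked-mono : ∀ {F F′} → (∀ e → F ∋ e → F′ ∋ e) → ∀ {u v} → Linked G F u v → Linked G F′ u v
  linked-mono F⊆F′ = Star.map λ { (e , e∈F , ends≡) → e , ∋⇒∈ (F⊆F′ e (∈⇒∋ e∈F)) , ends≡ }

  -- Represents the component by an end of an edge of the circuit, so that its position relative to
  -- a cut is known.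
  component-circuit : ∀ {F F′} → HasCircuit F → (∀ e → F ∋ e → F′ ∋ e) →
                      ∃[ e ] F ∋ e × ComponentHasCircuit G F′ (src e)
  component-circuit {F} {F′} (C , circuit@((e , e∈C) , _ , connected) , C⊆F) F⊆F′ =
    e , C⊆F e (∈⇒∋ e∈C) , C , circuit , (λ f∈C → ∋⇒∈ (C⊆F′ _ (∈⇒∋ f∈C))) ,
    λ v v≢0 → linked-mono C⊆F′ (connected (src e) v src≢0 v≢0)
    where
    C⊆F′ : ∀ f → C ∋ f → F′ ∋ f
    C⊆F′ f C∋f = F⊆F′ f (C⊆F f C∋f)
    src≢0 : degree G C (src e) ≢ 0
    src≢0 ≡0 = contradiction (≤-trans (inc-src e) (≤-trans (inc≤deg C (src e) (∈⇒∋ e∈C)) (≤-reflexive (trans (sym (degree≡deg C (src e))) ≡0)))) λ ()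

  inner-∋ : ∀ X {e} → inner X ∋ e → X ∋ src e × X ∋ tgt e
  inner-∋ X {e} p with lookup X (src e) | lookup X (tgt e) | trans (sym (inner-lookup X e)) p
  ... | true | true | _ = refl , refl

  inner-∁cut : ∀ X e → inner X ∋ e → ∁ (cut X) ∋ e
  inner-∁cut X e p with inner-∋ X p
  ... | s , t = ∁-∋ (cut X) (trans (cut-lookup X e) (cong₂ _xor_ s t))

  cut-∁ : ∀ X e → lookup (cut (∁ X)) e ≡ lookup (cut X) e
  cut-∁ X e = trans (cut-lookup (∁ X) e) (trans (cong₂ _xor_ (∁-lookup X (src e)) (∁-lookup X (tgt e)))
    (trans (xor-not (lookup X (src e)) (lookup X (tgt e))) (sym (cut-lookup X e))))
    where
    xor-not : ∀ a b → not a xor not b ≡ a xor b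
    xor-not true  true  = refl
    xor-not true  false = refl
    xor-not false true  = refl
    xor-not false false = refl

  ∣cut-∁∣ : ∀ X → ∣ cut (∁ X) ∣ ≡ ∣ cut X ∣
  ∣cut-∁∣ X = trans (∣∣≡sum (cut (∁ X))) (trans (sum-cong-≗ λ e → cong bit (cut-∁ X e)) (sym (∣∣≡sum (cut X))))

  -- An edge outside `cut X` has both or neither of its ends in `X`, so no walk avoiding the cut
  -- changes sides.
  same-side : ∀ X {u v} → Linked G (∁ (cut X)) u v → lookup X u ≡ lookup X v
  same-side X ε = refl
  same-side X ((e , e∈ , ends≡) ◅ rest) = trans (step ends≡) (same-side X rest)
    where
    equal : lookup X (src e) ≡ lookup X (tgt e)
    equal with lookup X (src e) | lookup X (tgt e) | trans (sym (cut-lookup X e)) (∁-∋⁻¹ (cut X) (∈⇒∋ e∈))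
    ... | true  | true  | _ = refl
    ... | false | false | _ = refl
    step : ∀ {a b} → ends e ≡ (a , b) ⊎ ends e ≡ (b , a) → lookup X a ≡ lookup X b
    step (inj₁ refl) = equal
    step (inj₂ refl) = sym equal

  cubic-volume : Cubic G → ∀ X → ∣ X ∣ * 3 ≡ ∣ cut X ∣ + 2 * ∣ inner X ∣
  cubic-volume cubic X = trans (regular-volume (λ _ → 1) X λ v → trans (sym (deg-⊤ v)) (cubic v))
    (cong₂ (λ a b → a + 2 * b) (weight-1 (cut X)) (weight-1 (inner X)))

  -- From `∣ X ∣ * 3 ≡ ∣ cut X ∣ + 2 * ∣ inner X ∣` and the bound on the cut, `X` spans at least as
  -- many edges as it has vertices.
  cubic-circuit : Cubic G → ∀ X → 1 ≤ ∣ X ∣ → ∣ cut X ∣ ≤ ∣ X ∣ → ¬ ¬ HasCircuit (inner X)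
  cubic-circuit cubic X X≥1 cut≤X = circuit-exists _ X (inner X) (λ e p → inner-∋ X p) ≤-refl X≥1
    (*-cancelˡ-≤ 2 (lin-edges (∣ X ∣) (∣ cut X ∣) (∣ inner X ∣) cut≤X (cubic-volume cubic X)))
    where
    lin-edges : ∀ x c i → c ≤ x → x * 3 ≡ c + 2 * i → 2 * x ≤ 2 * i
    lin-edges x c i c≤x eq = +-cancelˡ-≤ c (2 * x) (2 * i) (≤-trans (+-monoˡ-≤ (2 * x) c≤x) (≤-reflexive (trans (*-comm 3 x) eq)))

  -- Both sides contain circuits by `cubic-circuit`, and removing the cut separates them.
  small-cut : ∀ {k} → CyclicallyEdgeConnected G k → Cubic G → ∀ X → ∣ cut X ∣ < k →
              1 ≤ ∣ X ∣ → ∣ cut X ∣ ≤ ∣ X ∣ → 1 ≤ ∣ ∁ X ∣ → ∣ cut X ∣ ≤ ∣ ∁ X ∣ → ⊥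
  small-cut (_ , no-cut) cubic X cut<k X≥1 cut≤X ∁X≥1 cut≤∁X =
    cubic-circuit cubic X X≥1 cut≤X λ circuit →
    cubic-circuit cubic (∁ X) ∁X≥1 (≤-trans (≤-reflexive (∣cut-∁∣ X)) cut≤∁X) λ circuit′ →
    let e , e∈ , left = component-circuit {inner X} circuit (inner-∁cut X)
        f , f∈ , right = component-circuit {inner (∁ X)} circuit′ (λ g g∈ → ∁-∋ (cut X) (trans (sym (cut-∁ X g)) (∁-∋⁻¹ (cut (∁ X)) (inner-∁cut (∁ X) g g∈))))
    in no-cut (cut X) cut<k (src e , src f ,
         (λ l → ∋-∌ (proj₁ (inner-∋ X e∈)) (trans (same-side X l) (∁-∋⁻¹ X (proj₁ (inner-∋ (∁ X) f∈))))) , left , right)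

-- Maximum matchings, Gallai's lemma and critical vertex sets.

∅ : Subset n
∅ = tabulate λ _ → false

∅-∌ : (i : Fin n) → ∅ ∌ i
∅-∌ i = lookup∘tabulate (λ _ → false) i

∣∅∣ : ∣ ∅ {n} ∣ ≡ 0
∣∅∣ {n} = trans (∣∣≡sum (∅ {n})) (sum-zero _ λ i → χ-∌ (∅-∌ i))

∣∅⊕∣ : (i : Fin n) → ∣ ∅ ⊕ i ∣ ≡ 1
∣∅⊕∣ {n} i = trans (∣⊕∣ (∅ {n}) {i} (∅-∌ i)) (cong suc (∣∅∣ {n}))

module Matchings (G : Graph) where
  open Graph G
  open Incidence G
  open Circuits G

  two-ends : ∀ e {x y w} → 1 ≤ inc e x → 1 ≤ inc e y → x ≢ y → 1 ≤ inc e w → w ≡ x ⊎ w ≡ y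
  two-ends e {x} {y} {w} ex ey x≢y ew with inc-src-or-tgt e x ex | inc-src-or-tgt e y ey | inc-src-or-tgt e w ew
  ... | inj₁ p | inj₁ q | _      = contradiction (trans (sym p) q) x≢y
  ... | inj₂ p | inj₂ q | _      = contradiction (trans (sym p) q) x≢y
  ... | inj₁ p | inj₂ q | inj₁ r = inj₁ (trans (sym r) p)
  ... | inj₁ p | inj₂ q | inj₂ r = inj₂ (trans (sym r) q)
  ... | inj₂ p | inj₁ q | inj₁ r = inj₂ (trans (sym r) q)
  ... | inj₂ p | inj₁ q | inj₂ r = inj₁ (trans (sym r) p)

  degree-sum : ∀ M → sum (deg (χ M)) ≡ ∣ M ∣ * 2
  degree-sum M = trans (sum-cong-≗ λ v → sym (*-identityˡ (deg (χ M) v)))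
    (trans (handshake (χ M) (λ _ → 1)) (sum-regular M λ _ _ → refl))

  deg-⊖≤ : ∀ M {e} → M ∋ e → ∀ v → deg (χ (M ⊖ e)) v ≤ deg (χ M) v
  deg-⊖≤ M M∋e v = ≤-trans (m≤m+n _ _) (≤-reflexive (sym (deg-⊖ M M∋e v)))

  two-at : ∀ M {e f} v → M ∋ e → M ∋ f → e ≢ f → inc e v + inc f v ≤ deg (χ M) v
  two-at M {e} {f} v M∋e M∋f e≢f = ≤-trans (+-monoˡ-≤ (inc f v) (inc≤deg (M ⊖ f) v (⊖-∋⁺ M (e≢f ∘ sym) M∋e)))
    (≤-reflexive (sym (deg-⊖ M M∋f v)))

  -- One inequality expresses that edges of `M` are pairwise disjoint, that none is a loop and that
  -- all their ends lie in `W`.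
  IsMatching : Subset ∣V∣ → EdgeSet → Set
  IsMatching W M = ∀ v → deg (χ M) v ≤ χ W v

  isMatching? : ∀ W M → Dec (IsMatching W M)
  isMatching? W M = all? λ v → deg (χ M) v ≤? χ W v

  deg≤1 : ∀ {W M} → IsMatching W M → ∀ v → deg (χ M) v ≤ 1
  deg≤1 {W} matching v = ≤-trans (matching v) (χ≤1 W v)

  ⊕-fresh : ∀ M {e v} → 1 ≤ inc e v → deg (χ M) v ≡ 0 → M ∌ e
  ⊕-fresh M {e} {v} ev ≡0 with ∋? M e
  ... | inj₂ M∌e = M∌e
  ... | inj₁ M∋e = contradiction (≤-trans ev (≤-trans (inc≤deg M v M∋e) (≤-reflexive ≡0))) λ ()

  ⊕-matching : ∀ {W M} e → IsMatching W M → (∀ v → inc e v ≤ χ W v) → (∀ v → 1 ≤ inc e v → deg (χ M) v ≡ 0) → IsMatching W (M ⊕ e)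
  ⊕-matching {W} {M} e matching inc≤ free v = ≤-trans (≤-reflexive (deg-⊕ M (⊕-fresh M (inc-src e) (free _ (inc-src e))) v)) (bound (1 ≤? inc e v))
    where
    bound : Dec (1 ≤ inc e v) → deg (χ M) v + inc e v ≤ χ W v
    bound (yes ev) rewrite free v ev = inc≤ v
    bound (no ¬ev) rewrite n≤0⇒n≡0 (≤-pred (≰⇒> ¬ev)) | +-identityʳ (deg (χ M) v) = matching v

  inc≤-matching : ∀ {W M} {e} → IsMatching W M → M ∋ e → ∀ v → inc e v ≤ χ W v
  inc≤-matching {M = M} matching M∋e v = ≤-trans (inc≤deg M v M∋e) (matching v)

  IsMaximum : Subset ∣V∣ → EdgeSet → Set
  IsMaximum W M = IsMatching W M × (∀ N → IsMatching W N → ∣ N ∣ ≤ ∣ M ∣)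

  ∅-matching : ∀ W → IsMatching W ∅
  ∅-matching W v = ≤-trans (≤-reflexive (sum-zero _ λ e → cong (λ b → bit b * inc e v) (∅-∌ e))) z≤n

  maximum-exists : ∀ W → ∃[ M ] IsMaximum W M
  maximum-exists W with maximiser (isMatching? W) ∣_∣ ∣E∣ (λ M _ → ∣p∣≤n M) (∅ , ∅-matching W)
  ... | M , matching , max = M , matching , max

  module Gallai (W : Subset ∣V∣) (ν : ℕ) (bound : ∀ N → IsMatching W N → ∣ N ∣ ≤ ν) where

    IsMax : EdgeSet → Set
    IsMax M = IsMatching W M × ∣ M ∣ ≡ ν

    isMax? : ∀ M → Dec (IsMax M)
    isMax? M = isMatching? W M ×-dec (∣ M ∣ ℕ.≟ ν)

    Misses : EdgeSet → Vertex → Set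
    Misses M v = deg (χ M) v ≡ 0

    misses? : ∀ M v → Dec (Misses M v)
    misses? M v = deg (χ M) v ℕ.≟ 0

    -- The negation of the relation in Gallai's lemma. On the diagonal it says that some maximum
    -- matching misses the vertex, which is why `Equivalent` adds equality explicitly.
    Apart : Vertex → Vertex → Set
    Apart u v = ∃[ M ] IsMax M × Misses M u × Misses M v

    apart? : ∀ u v → Dec (Apart u v)
    apart? u v = anySubset? λ M → isMax? M ×-dec (misses? M u ×-dec misses? M v)

    apart-sym : ∀ {u v} → Apart u v → Apart v u
    apart-sym (M , max , p , q) = M , max , q , p

    -- Adding `e` would give a matching with more than `ν` edges.
    no-addition : ∀ {M} e → IsMax M → (∀ v → inc e v ≤ χ W v) → ¬ (∀ v → 1 ≤ inc e v → Misses M v)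
    no-addition {M} e (matching , size) inc≤ free =
      1+n≰n (≤-trans (≤-reflexive (trans (cong suc (sym size)) (sym (∣⊕∣ M (⊕-fresh M (inc-src e) (free _ (inc-src e)))))))
                     (bound (M ⊕ e) (⊕-matching {W} {M} e matching inc≤ free)))

    -- The size of the intersection, as a weighted sum so that `sum-χ+δ` computes its change under
    -- an exchange.
    common : EdgeSet → EdgeSet → ℕ
    common M N = sum λ e → χ N e * χ M e

    common≤ : ∀ M N → common M N ≤ ∣ M ∣
    common≤ M N = ≤-trans (sum-mono λ e → ≤-trans (*-monoˡ-≤ (χ M e) (χ≤1 N e)) (≤-reflexive (*-identityˡ (χ M e)))) (≤-reflexive (sym (∣∣≡sum M)))

    -- Gallai's lemma.  Among the maximum matchings that miss t, take N with
    -- the largest overlap with a maximum matching M that misses u and v.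
    -- Some x ≠ t is covered by M and not by N; trading the N-edge at the
    -- other end of the M-edge of x for that M-edge increases the overlap.
    gallai : ∀ {u v t} → u ≢ v → Apart u v → Apart t t → ¬ Apart u t → ¬ Apart t v → ⊥
    gallai {u} {v} {t} u≢v (M , (M-matching , ∣M∣) , Mu , Mv) (N₀ , N₀-max , N₀t , _) ¬ut ¬tv
      with maximiser {P = λ N → IsMax N × Misses N t} (λ N → isMax? N ×-dec misses? N t) (common M) (∣ M ∣) (λ N _ → common≤ M N) (N₀ , N₀-max , N₀t)
    ... | N , (N-max@(N-matching , ∣N∣) , Nt) , best = exchange (any? λ x → (1 ≤? deg (χ M) x) ×-dec (misses? N x ×-dec ¬? (x ≟ t)))
      where
      Nu : 1 ≤ deg (χ N) u
      Nu = n≢0⇒n>0 λ ≡0 → ¬ut (N , N-max , ≡0 , Nt)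
      Nv : 1 ≤ deg (χ N) v
      Nv = n≢0⇒n>0 λ ≡0 → ¬tv (N , N-max , Nt , ≡0)
      covered≢ : ∀ {x y} → 1 ≤ deg (χ N) x → Misses N y → x ≢ y
      covered≢ x≥1 y≡0 refl = contradiction (≤-trans x≥1 (≤-reflexive y≡0)) λ ()
      exchange : Dec (∃[ x ] 1 ≤ deg (χ M) x × Misses N x × x ≢ t) → ⊥
      -- Here every vertex other than `t` covered by `M` is covered by `N`. Moreover `N` covers `u`
      -- and `v`, as neither is apart from `t`. Counting the vertices covered by `M` with `u` and
      -- `v` against those covered by `N` with `t` gives `∣ M ∣ * 2 + 2 ≤ ∣ N ∣ * 2 + 1`, although
      -- the sizes agree.
      exchange (no none) = counting (∣ M ∣) (∣ N ∣) (trans ∣M∣ (sym ∣N∣)) (begin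
          ∣ M ∣ * 2 + 1 + 1 ≡⟨ cong₂ _+_ (cong₂ _+_ (sym (degree-sum M)) (sym (sum-one u))) (sym (sum-one v)) ⟩
          sum (deg (χ M)) + sum (δ u) + sum (δ v) ≡⟨ cong (_+ sum (δ v)) (sym (∑-distrib-+ (deg (χ M)) (δ u))) ⟩
          sum (λ x → deg (χ M) x + δ u x) + sum (δ v) ≡⟨ sym (∑-distrib-+ (λ x → deg (χ M) x + δ u x) (δ v)) ⟩
          sum (λ x → deg (χ M) x + δ u x + δ v x) ≤⟨ sum-mono pointwise ⟩
          sum (λ x → deg (χ N) x + δ t x) ≡⟨ ∑-distrib-+ (deg (χ N)) (δ t) ⟩
          sum (deg (χ N)) + sum (δ t) ≡⟨ cong₂ _+_ (degree-sum N) (sum-one t) ⟩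
          ∣ N ∣ * 2 + 1 ∎)
        where
        open ≤-Reasoning
        sum-one : ∀ {n} (i : Fin n) → sum (δ i) ≡ 1
        sum-one i = trans (sum-cong-≗ λ j → sym (*-identityʳ (δ i j))) (sum-δ i (λ _ → 1))
        counting : ∀ a b → a ≡ b → a * 2 + 1 + 1 ≤ b * 2 + 1 → ⊥
        counting a .a refl le = 1+n≰n (+-cancelˡ-≤ (a * 2) 2 1 (≤-trans (≤-reflexive (sym (+-assoc (a * 2) 1 1))) le))
        pointwise : ∀ x → deg (χ M) x + δ u x + δ v x ≤ deg (χ N) x + δ t x
        pointwise x with t ≟ x
        ... | yes refl rewrite δ-≢ (covered≢ Nu Nt) | δ-≢ (covered≢ Nv Nt) | Nt | +-identityʳ (deg (χ M) t) | +-identityʳ (deg (χ M) t) = deg≤1 {W} {M} M-matching t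
        ... | no t≢x with misses? N x
        ...   | yes Nx rewrite δ-≢ (covered≢ Nu Nx) | δ-≢ (covered≢ Nv Nx) | +-identityʳ (deg (χ M) x) | +-identityʳ (deg (χ M) x) =
                ≤-trans (≤-pred (≰⇒> λ Mx → none (x , Mx , Nx , t≢x ∘ sym))) z≤n
        ...   | no ¬Nx = ≤-trans (one (u ≟ x) (v ≟ x)) (≤-trans (n≢0⇒n>0 ¬Nx) (m≤m+n _ 0))
          where
          one : Dec (u ≡ x) → Dec (v ≡ x) → deg (χ M) x + δ u x + δ v x ≤ 1
          one (yes refl) _ rewrite Mu | δ-≢ (u≢v ∘ sym) | δ-refl u = ≤-refl
          one (no _) (yes refl) rewrite Mv | δ-≢ u≢v | δ-refl v = ≤-refl
          one (no u≢x) (no v≢x) rewrite δ-≢ u≢x | δ-≢ v≢x | +-identityʳ (deg (χ M) x) | +-identityʳ (deg (χ M) x) = deg≤1 {W} {M} M-matching x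
      exchange (yes (x , Mx , Nx , x≢t)) with deg-witness M x Mx
      ... | k , M∋k , kx with any? (λ y → (1 ≤? inc k y) ×-dec (1 ≤? deg (χ N) y))
      ...   | no free = no-addition {N} k N-max (inc≤-matching {W} {M} M-matching M∋k)
                          λ y ky → n≤0⇒n≡0 (≤-pred (≰⇒> λ Ny → free (y , ky , Ny)))
      ...   | yes (y , ky , Ny) with deg-witness N y Ny
      ...     | l , N∋l , ly = 1+n≰n (≤-trans (≤-reflexive (sym more)) (best N′ ((N′-matching , N′-size) , N′t)))
        where
        x≢y : x ≢ y
        x≢y = covered≢ Ny Nx ∘ sym
        N⊖l-free : ∀ w → 1 ≤ inc k w → deg (χ (N ⊖ l)) w ≡ 0
        N⊖l-free w kw with two-ends k kx ky x≢y kw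
        ... | inj₁ refl = n≤0⇒n≡0 (≤-trans (deg-⊖≤ N N∋l x) (≤-reflexive Nx))
        ... | inj₂ refl = n≤0⇒n≡0 (+-cancelʳ-≤ 1 _ 0 (≤-trans (+-monoʳ-≤ _ ly) (≤-trans (≤-reflexive (sym (deg-⊖ N N∋l y))) (deg≤1 {W} {N} N-matching y))))
        N⊖l∌k : N ⊖ l ∌ k
        N⊖l∌k = ⊕-fresh (N ⊖ l) kx (N⊖l-free x kx)
        N′ : EdgeSet
        N′ = N ⊖ l ⊕ k
        N′-matching : IsMatching W N′
        N′-matching = ⊕-matching {W} {N ⊖ l} k (λ v → ≤-trans (deg-⊖≤ N N∋l v) (N-matching v)) (inc≤-matching {W} {M} M-matching M∋k) N⊖l-free
        N′-size : ∣ N′ ∣ ≡ ν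
        N′-size = trans (∣⊕∣ (N ⊖ l) N⊖l∌k) (trans (sym (∣⊖∣ N N∋l)) ∣N∣)
        ¬kt : ¬ 1 ≤ inc k t
        ¬kt kt with two-ends k kx ky x≢y kt
        ... | inj₁ t≡x = x≢t (sym t≡x)
        ... | inj₂ refl = covered≢ Ny Nt refl
        N′t : Misses N′ t
        N′t = trans (deg-⊕ (N ⊖ l) N⊖l∌k t) (cong₂ _+_ (n≤0⇒n≡0 (≤-trans (deg-⊖≤ N N∋l t) (≤-reflexive Nt))) (n≤0⇒n≡0 (≤-pred (≰⇒> ¬kt))))
        M∌l : M ∌ l
        M∌l with ∋? M l
        ... | inj₂ p = p
        ... | inj₁ M∋l = contradiction (≤-trans (+-mono-≤ ky ly) (≤-trans (two-at M y M∋k M∋l k≢l) (deg≤1 {W} {M} M-matching y))) λ { (s≤s ()) }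
          where
          k≢l : k ≢ l
          k≢l refl = ∋-∌ N∋l (⊕-fresh N kx Nx)
        more : common M N′ ≡ suc (common M N)
        more = begin
          common M N′                      ≡⟨ sum-χ+δ N′ (N ⊖ l) k (χ-⊕ (N ⊖ l) N⊖l∌k) (χ M) ⟩
          common M (N ⊖ l) + χ M k         ≡⟨ cong (common M (N ⊖ l) +_) (χ-∋ M∋k) ⟩
          common M (N ⊖ l) + 1             ≡⟨ +-comm _ 1 ⟩
          suc (common M (N ⊖ l))           ≡⟨ cong suc (sym (+-identityʳ _)) ⟩
          suc (common M (N ⊖ l) + 0)       ≡⟨ cong (λ z → suc (common M (N ⊖ l) + z)) (sym (χ-∌ M∌l)) ⟩
          suc (common M (N ⊖ l) + χ M l)   ≡⟨ cong suc (sym (sum-χ+δ N (N ⊖ l) l (χ-⊖ N N∋l) (χ M))) ⟩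
          suc (common M N)                 ∎
          where open ≡-Reasoning

  Missable : Subset ∣V∣ → ℕ → Vertex → Set
  Missable W ν v = ∃[ N ] (IsMatching W N × ∣ N ∣ ≡ ν) × deg (χ N) v ≡ 0

  missable? : ∀ W ν v → Dec (Missable W ν v)
  missable? W ν v = anySubset? λ N → (isMatching? W N ×-dec (∣ N ∣ ℕ.≟ ν)) ×-dec (deg (χ N) v ℕ.≟ 0)

  -- Deleting a vertex that every maximum matching covers lowers the maximum,
  -- so |W| minus the maximum never decreases along the recursion.
  critical-subset : ∀ s W M → ∣ W ∣ ≤ s → IsMaximum W M →
    ∃[ W′ ] ∃[ M′ ] (∀ v → W′ ∋ v → W ∋ v) × IsMaximum W′ M′ × ∣ W ∣ + ∣ M′ ∣ ≤ ∣ W′ ∣ + ∣ M ∣ × (∀ v → W′ ∋ v → Missable W′ ∣ M′ ∣ v)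
  critical-subset s W M size max@(matching , best) with any? (λ v → (1 ≤? χ W v) ×-dec ¬? (missable? W ∣ M ∣ v))
  ... | no none = W , M , (λ _ p → p) , max , ≤-refl , λ v W∋v → decidable-stable (missable? W ∣ M ∣ v) λ ¬m → none (v , ≤-reflexive (sym (χ-∋ W∋v)) , ¬m)
  critical-subset zero    W M size max | yes (v , Wv , _) =
    contradiction (≤-trans (∋⇒1≤∣∣ W (χ-positive {S = W} Wv)) size) λ ()
  critical-subset (suc s) W M size (matching , best) | yes (v , Wv , ¬missable) with maximum-exists (W ⊖ v)
  ... | M₁ , max₁@(matching₁ , _) with critical-subset s (W ⊖ v) M₁ (≤-pred (≤-trans (≤-reflexive (sym (∣⊖∣ W (χ-positive {S = W} Wv)))) size)) max₁
  ... | W′ , M′ , W′⊆ , max′ , sizes , critical =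
    W′ , M′ , (λ u p → proj₂ (⊖-∋⁻ W (W′⊆ u p))) , max′ ,
    (begin
      ∣ W ∣ + ∣ M′ ∣              ≡⟨ cong (_+ ∣ M′ ∣) (∣⊖∣ W W∋v) ⟩
      suc (∣ W ⊖ v ∣ + ∣ M′ ∣)    ≤⟨ s≤s sizes ⟩
      suc (∣ W′ ∣ + ∣ M₁ ∣)       ≡⟨ sym (+-suc _ _) ⟩
      ∣ W′ ∣ + suc ∣ M₁ ∣         ≤⟨ +-monoʳ-≤ (∣ W′ ∣) M₁<M ⟩
      ∣ W′ ∣ + ∣ M ∣              ∎) , critical
    where
    open ≤-Reasoning
    W∋v : W ∋ v
    W∋v = χ-positive {S = W} Wv
    in-W : IsMatching W M₁
    in-W u = ≤-trans (matching₁ u) (≤-trans (m≤m+n _ _) (≤-reflexive (sym (χ-⊖ W W∋v u))))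
    M₁<M : ∣ M₁ ∣ < ∣ M ∣
    M₁<M = ≤∧≢⇒< (best M₁ in-W) λ same → ¬missable (M₁ , (in-W , same) , n≤0⇒n≡0 (≤-trans (matching₁ v) (≤-reflexive (χ-∌ (⊖-∌ W v)))))

-- Arithmetic of parities and deficiencies.

sum-δ₁ : (i : Fin n) → sum (δ i) ≡ 1
sum-δ₁ i = trans (sum-cong-≗ λ j → sym (*-identityʳ (δ i j))) (sum-δ i (λ _ → 1))

sum≤1 : (f : Fin n → ℕ) → (∀ i → f i ≤ 1) → (∀ i j → 1 ≤ f i → 1 ≤ f j → i ≡ j) → sum f ≤ 1
sum≤1 f f≤1 unique with any? (λ i → 1 ≤? f i)
... | no  none     = ≤-trans (≤-reflexive (sum-zero f λ i → n≤0⇒n≡0 (≤-pred (≰⇒> λ fi → none (i , fi))))) z≤n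
... | yes (i , fi) = ≤-trans (sum-mono below) (≤-reflexive (sum-δ₁ i))
  where
  below : ∀ j → f j ≤ δ i j
  below j with i ≟ j
  ... | yes _   = f≤1 j
  ... | no  i≢j = ≤-pred (≰⇒> λ fj → i≢j (unique i j fi fj))

double≢odd : ∀ a b → a * 2 ≢ suc (b * 2)
double≢odd (suc a) (suc b) eq = double≢odd a b (cong (λ x → x ∸ 2) eq)

-- For an odd vertex set in a cubic graph, `s`, `c` and `i` count its vertices, cut edges and inner
-- edges. If `s` is at least 3, then `c < 4` is excluded by the last hypothesis and `c ≡ 4` by
-- parity. If `s ≡ 1`, one inner edge would leave `c ≡ 1`, which is excluded likewise, and more do
-- not fit.
odd-order-cut : ∀ s c i k → s ≡ suc (k * 2) → s * 3 ≡ c + 2 * i → c < 5 → (c < 4 → c ≤ s → ⊥) → s ≡ 1 × c ≡ 3 × i ≡ 0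
odd-order-cut .1 c zero          zero refl eq c<5 big = refl , sym (trans eq (+-identityʳ c)) , refl
odd-order-cut .1 c (suc zero)    zero refl eq c<5 big = ⊥-elim (big (s≤s (≤-trans (≤-reflexive c≡1) (s≤s z≤n))) (≤-reflexive c≡1))
  where
  c≡1 : c ≡ 1
  c≡1 = +-cancelʳ-≡ 2 c 1 (sym eq)
odd-order-cut .1 c (suc (suc i)) zero refl eq c<5 big = contradiction (≤-trans (lin-i i) (≤-trans (m≤n+m _ c) (≤-reflexive (sym eq)))) λ { (s≤s (s≤s (s≤s ()))) }
  where
  lin-i : ∀ i → 4 ≤ 2 * suc (suc i)
  lin-i i = *-monoʳ-≤ 2 {2} {suc (suc i)} (s≤s (s≤s z≤n))
odd-order-cut s c i (suc k) refl eq c<5 big with m≤n⇒m<n∨m≡n (≤-pred c<5)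
... | inj₁ c<4  = ⊥-elim (big c<4 (≤-trans (≤-pred c<4) (s≤s (s≤s (s≤s z≤n)))))
... | inj₂ refl = ⊥-elim (double≢odd (2 + i) (4 + k * 3) (trans (left i) (trans (sym eq) (right k))))
  where
  left : ∀ i → (2 + i) * 2 ≡ 4 + 2 * i
  left i = cong (4 +_) (*-comm i 2)
  right : ∀ k → suc (suc k * 2) * 3 ≡ suc ((4 + k * 3) * 2)
  right k = cong (9 +_) (trans (*-assoc k 2 3) (sym (*-assoc k 3 2)))

-- Used with `w`, `m` for `∣ W ∣` and its maximum matching, `m′`, `a`, `r` for the matching,
-- complement and missed vertices of the critical subset, and `p` for a perfect matching. Since `w`
-- is even, `m * 2 < w` leaves a gap of at least two. Together with `w ≤ r + m′ + m` this gives
-- `w + 2 ≤ (r + m′) * 2`, and then `a` is bounded by its defining equation.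
deficiency : ∀ w m m′ a r p → w + m′ ≤ r + m′ * 2 + m → a + (r + m′ * 2) ≡ w + 4 → m * 2 < w → w + 4 ≡ p * 2 → a ≤ r + 2
deficiency w m m′ a r p sizes a≡ m<w w≡ = count w m m′ a r even sizes (≤-reflexive a≡)
  where
  m+2<p : m + 2 < p
  m+2<p = *-cancelʳ-< 2 (m + 2) p (≤-trans (s≤s (≤-reflexive (*-distribʳ-+ 2 m 2))) (≤-trans (+-monoˡ-≤ 4 m<w) (≤-reflexive w≡)))
  shift : ∀ m → m * 2 + 2 + 4 ≡ suc (m + 2) * 2
  shift m = trans (+-assoc (m * 2) 2 4) (trans (sym (+-assoc (m * 2) 4 2)) (trans (+-comm (m * 2 + 4) 2) (cong (2 +_) (sym (*-distribʳ-+ 2 m 2)))))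
  even : m * 2 + 2 ≤ w
  even = +-cancelʳ-≤ 4 (m * 2 + 2) w (≤-trans (≤-reflexive (shift m)) (≤-trans (*-monoˡ-≤ 2 m+2<p) (≤-reflexive (sym w≡))))
  count : ∀ w m m′ a r → m * 2 + 2 ≤ w → w + m′ ≤ r + m′ * 2 + m → a + (r + m′ * 2) ≤ w + 4 → a ≤ r + 2
  count w m m′ a r h₁ h₂ h₃ = +-cancelʳ-≤ (r + m′ * 2) a (r + 2) (begin
    a + (r + m′ * 2)       ≤⟨ h₃ ⟩
    w + (2 + 2)            ≡⟨ sym (+-assoc w 2 2) ⟩
    w + 2 + 2              ≤⟨ +-monoˡ-≤ 2 w+2≤ ⟩
    s + s + 2              ≡⟨ cong (_+ 2) (trans (interchange r m′ r m′) (trans (+-assoc r r (m′ + m′)) (cong (λ z → r + (r + z)) (double m′)))) ⟩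
    r + (r + m′ * 2) + 2   ≡⟨ xy∙z≈xz∙y r (r + m′ * 2) 2 ⟩
    r + 2 + (r + m′ * 2)   ∎)
    where
    open ≤-Reasoning
    s : ℕ
    s = r + m′
    double : ∀ k → k + k ≡ k * 2
    double k = trans (cong (k +_) (sym (+-identityʳ k))) (*-comm 2 k)
    w≤ : w ≤ s + m
    w≤ = +-cancelʳ-≤ m′ w (s + m) (≤-trans h₂ (≤-reflexive (begin-equality
      r + m′ * 2 + m     ≡⟨ cong (λ z → r + z + m) (sym (double m′)) ⟩
      r + (m′ + m′) + m  ≡⟨ cong (_+ m) (sym (+-assoc r m′ m′)) ⟩
      s + m′ + m         ≡⟨ xy∙z≈xz∙y s m′ m ⟩
      s + m + m′         ∎)))
    w+2≤ : w + 2 ≤ s + s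
    w+2≤ = +-cancelʳ-≤ w (w + 2) (s + s) (begin
      w + 2 + w              ≡⟨ xy∙z≈xz∙y w 2 w ⟩
      w + w + 2              ≤⟨ +-monoˡ-≤ 2 (+-mono-≤ w≤ w≤) ⟩
      s + m + (s + m) + 2    ≡⟨ cong (_+ 2) (interchange s m s m) ⟩
      s + s + (m + m) + 2    ≡⟨ +-assoc (s + s) (m + m) 2 ⟩
      s + s + (m + m + 2)    ≤⟨ +-monoʳ-≤ (s + s) (≤-trans (≤-reflexive (cong (_+ 2) (double m))) h₁) ⟩
      s + s + w              ∎)

-- The weight of odd cuts.

module Extension (G : Graph) (cubic : Cubic G) (connected : CyclicallyEdgeConnected G 4) where
  open Graph G
  open Incidence G
  open Circuits G
  open Matchings G

  Perfect : EdgeSet → Set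
  Perfect M = ∀ v → deg (χ M) v ≡ 1

  cubic-deg : ∀ v → deg (λ _ → 1) v ≡ 3
  cubic-deg v = trans (sym (deg-⊤ v)) (cubic v)

  perfect-size : ∀ {P} → Perfect P → ∣V∣ ≡ ∣ P ∣ * 2
  perfect-size {P} perfect = trans (sym (trans (sum-cong-≗ perfect) (trans (sum-const ∣V∣ 1) (*-identityʳ ∣V∣)))) (degree-sum P)

  sum-inc : ∀ e → sum (inc e) ≡ 2
  sum-inc e = trans (sum-cong-≗ (inc≡ e)) (trans (∑-distrib-+ (δ (src e)) (δ (tgt e))) (cong₂ _+_ (sum-δ₁ (src e)) (sum-δ₁ (tgt e))))

  off-weight : EdgeSet → Edge → ℕ
  off-weight P e = 1 + χ (∁ P) e

  off-weight-deg : ∀ {P} → Perfect P → ∀ v → deg (off-weight P) v ≡ 5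
  off-weight-deg {P} perfect v = trans (deg-+ (λ _ → 1) (χ (∁ P)) v) (cong₂ _+_ (cubic-deg v) off≡2)
    where
    off≡2 : deg (χ (∁ P)) v ≡ 2
    off≡2 = +-cancelˡ-≡ 1 _ 2 (trans (cong (_+ deg (χ (∁ P)) v) (sym (perfect v)))
              (trans (sym (deg-+ (χ P) (χ (∁ P)) v)) (trans (deg-cong (χ-∁ P) v) (cubic-deg v))))

  -- Every edge has weight at least 1, so a cut of five edges is heavy enough. By `odd-order-cut`
  -- and cyclic connectivity a smaller odd cut surrounds a single vertex without inner edges, and
  -- its weight is the weighted degree 5. The bound on the complement provides the other circuit in
  -- `small-cut`.
  odd-cut-weight : ∀ {P} → Perfect P → ∀ X k → ∣ X ∣ ≡ suc (k * 2) → 4 ≤ ∣ ∁ X ∣ → 5 ≤ weight (off-weight P) (cut X)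
  odd-cut-weight {P} perfect X k odd ∁X≥4 with 5 ≤? ∣ cut X ∣
  ... | yes cut≥5 = ≤-trans cut≥5 (≤-trans (≤-reflexive (∣∣≡sum (cut X))) (sum-mono λ e → ≤-trans (≤-reflexive (sym (*-identityˡ (χ (cut X) e)))) (*-monoˡ-≤ (χ (cut X) e) (m≤m+n 1 (χ (∁ P) e)))))
  ... | no  cut≱5 with odd-order-cut (∣ X ∣) (∣ cut X ∣) (∣ inner X ∣) k odd (cubic-volume cubic X) (≰⇒> cut≱5) small
    where
    small : ∣ cut X ∣ < 4 → ∣ cut X ∣ ≤ ∣ X ∣ → ⊥
    small cut<4 cut≤X = small-cut connected cubic X cut<4 (≤-trans (s≤s z≤n) (≤-reflexive (sym odd))) cut≤X
      (≤-trans (s≤s z≤n) ∁X≥4) (≤-trans (<⇒≤ cut<4) ∁X≥4)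
  ... | X≡1 , _ , inner≡0 = ≤-reflexive (begin
      5                                                                           ≡⟨ cong (_* 5) (sym X≡1) ⟩
      ∣ X ∣ * 5                                                                   ≡⟨ regular-volume (off-weight P) X (off-weight-deg {P} perfect) ⟩
      weight (off-weight P) (cut X) + 2 * weight (off-weight P) (inner X)         ≡⟨ cong (λ z → weight (off-weight P) (cut X) + 2 * z) (sum-zero _ inner-zero) ⟩
      weight (off-weight P) (cut X) + 0                                           ≡⟨ +-identityʳ _ ⟩
      weight (off-weight P) (cut X)                                               ∎)
    where
    open ≡-Reasoning
    inner-zero : ∀ e → off-weight P e * χ (inner X) e ≡ 0
    inner-zero e with ∋? (inner X) e
    ... | inj₂ ∌e = trans (cong (off-weight P e *_) (χ-∌ ∌e)) (*-zeroʳ (off-weight P e))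
    ... | inj₁ ∋e = contradiction (≤-trans (∋⇒1≤∣∣ (inner X) ∋e) (≤-reflexive inner≡0)) λ ()

-- Gallai classes of a critical vertex set.

module Classes (G : Graph) (U : Subset (Graph.∣V∣ G)) (M : Graph.EdgeSet G)
    (maximum : Matchings.IsMaximum G U M)
    (critical : ∀ v → U ∋ v → Matchings.Missable G U ∣ M ∣ v) where
  open Graph G
  open Incidence G
  open Circuits G
  open Matchings G
  open Gallai U (∣ M ∣) (proj₂ maximum)

  M-max : IsMax M
  M-max = proj₁ maximum , refl

  root? : ∀ v → Dec (1 ≤ χ U v × Misses M v)
  root? v = (1 ≤? χ U v) ×-dec misses? M v

  -- The vertices of `U` missed by `M`; they serve as representatives of the odd classes.
  roots : Subset ∣V∣
  roots = filter root?

  root-∈ : ∀ {v} → roots ∋ v → U ∋ v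
  root-∈ {v} R∋v = χ-positive {S = U} {v} (proj₁ (filter⁻ root? R∋v))

  root-misses : ∀ {v} → roots ∋ v → Misses M v
  root-misses {v} R∋v = proj₂ (filter⁻ root? R∋v)

  -- Each vertex of `U` is either a root or covered by `M` exactly once, and `M` covers nothing
  -- outside `U`.
  roots-count : ∣ roots ∣ + ∣ M ∣ * 2 ≡ ∣ U ∣
  roots-count = begin
    ∣ roots ∣ + ∣ M ∣ * 2                ≡⟨ cong₂ _+_ (∣∣≡sum roots) (sym (degree-sum M)) ⟩
    sum (χ roots) + sum (deg (χ M))      ≡⟨ sym (∑-distrib-+ (χ roots) (deg (χ M))) ⟩
    sum (λ v → χ roots v + deg (χ M) v)  ≡⟨ sum-cong-≗ pointwise ⟩
    sum (χ U)                            ≡⟨ sym (∣∣≡sum U) ⟩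
    ∣ U ∣                                ∎
    where
    open ≡-Reasoning
    pointwise : ∀ v → χ roots v + deg (χ M) v ≡ χ U v
    pointwise v with ∋? roots v
    ... | inj₁ R∋v = trans (cong₂ _+_ (χ-∋ R∋v) (root-misses R∋v)) (sym (χ-∋ (root-∈ R∋v)))
    ... | inj₂ R∌v with ∋? U v
    ...   | inj₁ U∋v = trans (cong (_+ deg (χ M) v) (χ-∌ R∌v)) (≤-antisym (proj₁ maximum v)
              (≤-trans (≤-reflexive (χ-∋ U∋v)) (n≢0⇒n>0 λ ≡0 → ∋-∌ (filter⁺ root? (≤-reflexive (sym (χ-∋ U∋v)) , ≡0)) R∌v)))
    ...   | inj₂ U∌v = trans (cong₂ _+_ (χ-∌ R∌v) (n≤0⇒n≡0 (≤-trans (proj₁ maximum v) (≤-reflexive (χ-∌ U∌v))))) (sym (χ-∌ U∌v))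

  Equivalent : Vertex → Vertex → Set
  Equivalent u v = u ≡ v ⊎ ¬ Apart u v

  class? : ∀ r v → Dec (1 ≤ χ U v × Equivalent v r)
  class? r v = (1 ≤? χ U v) ×-dec ((v ≟ r) ⊎-dec ¬? (apart? v r))

  class : Vertex → Subset ∣V∣
  class r = filter (class? r)

  class⁺ : ∀ {r v} → U ∋ v → Equivalent v r → class r ∋ v
  class⁺ {r} U∋v eq = filter⁺ (class? r) (≤-reflexive (sym (χ-∋ U∋v)) , eq)

  class⁻ : ∀ {r v} → class r ∋ v → U ∋ v × Equivalent v r
  class⁻ {r} {v} p = let Uv , eq = filter⁻ (class? r) p in χ-positive {S = U} {v} Uv , eq

  class-∌ : ∀ {r v} → U ∌ v → class r ∌ v
  class-∌ {r} U∌v = filter-∌ (class? r) λ { (Uv , _) → contradiction (≤-trans Uv (≤-reflexive (χ-∌ U∌v))) λ () }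

  apart-refl : ∀ {v} → U ∋ v → Apart v v
  apart-refl {v} U∋v = let N , max , miss = critical v U∋v in N , max , miss , miss

  roots-apart : ∀ {r s} → roots ∋ r → roots ∋ s → Apart r s
  roots-apart R∋r R∋s = M , M-max , root-misses R∋r , root-misses R∋s

  -- Distinct roots are apart, as `M` misses both. By Gallai's lemma no vertex is equivalent to
  -- both.
  class-unique : ∀ {r s v} → roots ∋ r → roots ∋ s → class r ∋ v → class s ∋ v → r ≡ s
  class-unique {r} {s} {v} R∋r R∋s r∋v s∋v with r ≟ s
  ... | yes r≡s = r≡s
  ... | no  r≢s = ⊥-elim (clash (proj₂ (class⁻ r∋v)) (proj₂ (class⁻ s∋v)))
    where
    clash : Equivalent v r → Equivalent v s → ⊥
    clash (inj₁ refl) (inj₁ refl) = r≢s refl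
    clash (inj₁ refl) (inj₂ ¬vs)  = ¬vs (roots-apart R∋r R∋s)
    clash (inj₂ ¬vr)  (inj₁ refl) = ¬vr (roots-apart R∋s R∋r)
    clash (inj₂ ¬vr)  (inj₂ ¬vs)  = gallai r≢s (roots-apart R∋r R∋s) (apart-refl (proj₁ (class⁻ r∋v))) (¬vr ∘ apart-sym) ¬vs

  -- Transitivity of the equivalence. Gallai's lemma applies with `a` in the middle, because
  -- criticality makes `a` missable.
  class-closed : ∀ {r a b} → U ∋ b → Equivalent a b → class r ∋ a → class r ∋ b
  class-closed {r} {a} {b} U∋b a~b r∋a with b ≟ r | apart? b r
  ... | yes b≡r | _      = class⁺ U∋b (inj₁ b≡r)
  ... | no  _   | no ¬br = class⁺ U∋b (inj₂ ¬br)
  ... | no  b≢r | yes br = ⊥-elim (clash a~b (proj₂ (class⁻ r∋a)))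
    where
    clash : Equivalent a b → Equivalent a r → ⊥
    clash (inj₁ refl) (inj₁ a≡r)  = b≢r a≡r
    clash (inj₁ refl) (inj₂ ¬ar)  = ¬ar br
    clash (inj₂ ¬ab)  (inj₁ refl) = ¬ab (apart-sym br)
    clash (inj₂ ¬ab)  (inj₂ ¬ar)  = gallai b≢r br (apart-refl (proj₁ (class⁻ r∋a))) (¬ab ∘ apart-sym) ¬ar

  -- A maximum matching missing both ends could be enlarged by `e`.
  edge-equivalent : ∀ e → U ∋ src e → U ∋ tgt e → Equivalent (src e) (tgt e)
  edge-equivalent e U∋s U∋t with src e ≟ tgt e
  ... | yes s≡t = inj₁ s≡t
  ... | no  s≢t = inj₂ λ { (N , N-max , Ns , Nt) → no-addition {N} e N-max inc≤ (λ v ev → free {N} Ns Nt (inc-src-or-tgt e v ev)) }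
    where
    free : ∀ {N v} → Misses N (src e) → Misses N (tgt e) → src e ≡ v ⊎ tgt e ≡ v → Misses N v
    free Ns Nt (inj₁ refl) = Ns
    free Ns Nt (inj₂ refl) = Nt
    inc≤ : ∀ v → inc e v ≤ χ U v
    inc≤ v = ≤-trans (≤-reflexive (inc≡ e v)) (bound (src e ≟ v) (tgt e ≟ v))
      where
      bound : Dec (src e ≡ v) → Dec (tgt e ≡ v) → δ (src e) v + δ (tgt e) v ≤ χ U v
      bound (yes refl) (yes t≡s) = contradiction (sym t≡s) s≢t
      bound (yes refl) (no t≢)   = ≤-reflexive (trans (cong₂ _+_ (δ-refl v) (δ-≢ t≢)) (sym (χ-∋ U∋s)))
      bound (no s≢) (yes refl)   = ≤-reflexive (trans (cong₂ _+_ (δ-≢ s≢) (δ-refl v)) (sym (χ-∋ U∋t)))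
      bound (no s≢) (no t≢)      = ≤-trans (≤-reflexive (cong₂ _+_ (δ-≢ s≢) (δ-≢ t≢))) z≤n

  equivalent-sym : ∀ {a b} → Equivalent a b → Equivalent b a
  equivalent-sym (inj₁ p)   = inj₁ (sym p)
  equivalent-sym (inj₂ ¬ab) = inj₂ (¬ab ∘ apart-sym)

  inner-edge-uncut : ∀ r e → U ∋ src e → U ∋ tgt e → cut (class r) ∌ e
  inner-edge-uncut r e U∋s U∋t = trans (cut-lookup (class r) e) (same (∋? (class r) (src e)) (∋? (class r) (tgt e)))
    where
    eq = edge-equivalent e U∋s U∋t
    same : class r ∋ src e ⊎ class r ∌ src e → class r ∋ tgt e ⊎ class r ∌ tgt e → lookup (class r) (src e) xor lookup (class r) (tgt e) ≡ false
    same (inj₁ p) (inj₁ q) rewrite p | q = refl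
    same (inj₂ p) (inj₂ q) rewrite p | q = refl
    same (inj₁ p) (inj₂ q) = ⊥-elim (∋-∌ (class-closed U∋t eq p) q)
    same (inj₂ p) (inj₁ q) = ⊥-elim (∋-∌ (class-closed U∋s (equivalent-sym eq) q) p)

  outer-edge-uncut : ∀ r e → U ∌ src e → U ∌ tgt e → cut (class r) ∌ e
  outer-edge-uncut r e U∌s U∌t = trans (cut-lookup (class r) e) (cong₂ _xor_ (class-∌ {r} U∌s) (class-∌ {r} U∌t))

  matching-in-U : ∀ {e} → M ∋ e → U ∋ src e × U ∋ tgt e
  matching-in-U {e} M∋e = χ-positive {S = U} (≤-trans (inc-src e) (inc≤-matching {U} {M} (proj₁ maximum) M∋e (src e))) ,
                          χ-positive {S = U} (≤-trans (inc-tgt e) (inc≤-matching {U} {M} (proj₁ maximum) M∋e (tgt e)))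

  -- No edge of `M` leaves the class, by `edge-equivalent`. Within it `M` misses `r` alone, since
  -- any other missed vertex would be apart from `r`. Hence `M` pairs up the rest of the class.
  class-odd : ∀ {r} → roots ∋ r → ∣ class r ∣ ≡ suc (weight (χ M) (inner (class r)) * 2)
  class-odd {r} R∋r = begin
    ∣ C ∣                                                        ≡⟨ ∣∣≡sum C ⟩
    sum (χ C)                                                    ≡⟨ sum-cong-≗ (λ v → sym (pointwise v)) ⟩
    sum (λ v → δ r v + χ C v * deg (χ M) v)                      ≡⟨ ∑-distrib-+ (δ r) (λ v → χ C v * deg (χ M) v) ⟩
    sum (δ r) + sum (λ v → χ C v * deg (χ M) v)                  ≡⟨ cong₂ _+_ (sum-δ₁ r) (volume (χ M) C) ⟩
    suc (weight (χ M) (cut C) + 2 * weight (χ M) (inner C))      ≡⟨ cong (λ z → suc (z + 2 * weight (χ M) (inner C))) (sum-zero _ uncut) ⟩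
    suc (2 * weight (χ M) (inner C))                             ≡⟨ cong suc (*-comm 2 (weight (χ M) (inner C))) ⟩
    suc (weight (χ M) (inner C) * 2)                             ∎
    where
    open ≡-Reasoning
    C : Subset ∣V∣
    C = class r
    uncut : ∀ e → χ M e * χ (cut C) e ≡ 0
    uncut e with ∋? M e
    ... | inj₂ M∌e = cong (_* χ (cut C) e) (χ-∌ M∌e)
    ... | inj₁ M∋e = let U∋s , U∋t = matching-in-U M∋e in
                     trans (cong (χ M e *_) (χ-∌ (inner-edge-uncut r e U∋s U∋t))) (*-zeroʳ (χ M e))
    pointwise : ∀ v → δ r v + χ C v * deg (χ M) v ≡ χ C v
    pointwise v with r ≟ v
    ... | yes refl = trans (cong₂ _+_ {u = χ C r * deg (χ M) r} refl (trans (cong (χ C r *_) (root-misses R∋r)) (*-zeroʳ (χ C r)))) (sym (χ-∋ (class⁺ (root-∈ R∋r) (inj₁ refl))))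
    ... | no r≢v with ∋? C v
    ...   | inj₂ C∌v = trans (cong (_* deg (χ M) v) (χ-∌ C∌v)) (sym (χ-∌ C∌v))
    ...   | inj₁ C∋v = trans (bit-*-true _ C∋v) (trans (≤-antisym (deg≤1 {U} {M} (proj₁ maximum) v) (n≢0⇒n>0 covered)) (sym (χ-∋ C∋v)))
      where
      covered : deg (χ M) v ≢ 0
      covered ≡0 with class⁻ C∋v
      ... | U∋v , inj₁ v≡r = r≢v (sym v≡r)
      ... | U∋v , inj₂ ¬vr = ¬vr (M , M-max , ≡0 , root-misses R∋r)

  -- A class cut by `e` must contain the end of `e` opposite to the one outside `U`, and that end
  -- lies in the class of at most one root.
  cuts-at : ∀ e → U ∌ src e ⊎ U ∌ tgt e → sum (λ r → χ roots r * χ (cut (class r)) e) ≤ 1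
  cuts-at e outside = sum≤1 _ (λ r → *-mono-≤ (χ≤1 roots r) (χ≤1 (cut (class r)) e)) unique
    where
    split : ∀ r → 1 ≤ χ roots r * χ (cut (class r)) e → roots ∋ r × cut (class r) ∋ e
    split r p with ∋? roots r | ∋? (cut (class r)) e
    ... | inj₁ R∋r | inj₁ cut∋e = R∋r , cut∋e
    ... | inj₂ R∌r | _          = contradiction (≤-trans p (≤-reflexive (cong (_* χ (cut (class r)) e) (χ-∌ R∌r)))) λ ()
    ... | inj₁ _   | inj₂ cut∌e = contradiction (≤-trans p (≤-reflexive (trans (cong (χ roots r *_) (χ-∌ cut∌e)) (*-zeroʳ (χ roots r))))) λ ()
    other-end : U ∌ src e ⊎ U ∌ tgt e → ∀ r → cut (class r) ∋ e → (U ∌ src e × class r ∋ tgt e) ⊎ (U ∌ tgt e × class r ∋ src e)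
    other-end (inj₁ U∌s) r cut∋e = inj₁ (U∌s , trans (sym (cong (_xor lookup (class r) (tgt e)) (class-∌ {r} U∌s))) (trans (sym (cut-lookup (class r) e)) cut∋e))
    other-end (inj₂ U∌t) r cut∋e = inj₂ (U∌t , trans (sym (xor-identityʳ (lookup (class r) (src e)))) (trans (sym (cong (lookup (class r) (src e) xor_) (class-∌ {r} U∌t))) (trans (sym (cut-lookup (class r) e)) cut∋e)))
    unique : ∀ r s → 1 ≤ χ roots r * χ (cut (class r)) e → 1 ≤ χ roots s * χ (cut (class s)) e → r ≡ s
    unique r s p q with split r p | split s q
    ... | R∋r , r∋e | R∋s , s∋e with other-end outside r r∋e | other-end outside s s∋e
    ... | inj₁ (_ , r∋t) | inj₁ (_ , s∋t) = class-unique R∋r R∋s r∋t s∋t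
    ... | inj₂ (_ , r∋s) | inj₂ (_ , s∋s) = class-unique R∋r R∋s r∋s s∋s
    ... | inj₁ (_ , r∋t) | inj₂ (U∌t , _) = ⊥-elim (∋-∌ (proj₁ (class⁻ r∋t)) U∌t)
    ... | inj₂ (_ , r∋s) | inj₁ (U∌s , _) = ⊥-elim (∋-∌ (proj₁ (class⁻ r∋s)) U∌s)

-- Perfect matchings through the two outer edges of a path.

module PathExtension (G : Graph) (cubic : Cubic G) (connected : CyclicallyEdgeConnected G 4) where
  open Graph G
  open Incidence G
  open Circuits G
  open Matchings G
  open Extension G cubic connected

  -- The path is encoded by incidence counts: `disjoint` keeps `e` and `f` from sharing an end, and
  -- `joins` puts each end of `h` on `e` or `f`.
  module _ {P : EdgeSet} (perfect : Perfect P) (e h f : Edge)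
           (disjoint : ∀ v → inc e v + inc f v ≤ 1)
           (joins : ∀ v → 1 ≤ inc h v → 1 ≤ inc e v + inc f v)
           (e≢h : e ≢ h) (f≢h : f ≢ h)
           (P∌e : P ∌ e) (P∌h : P ∌ h) (P∌f : P ∌ f) where

    Target : EdgeSet → Set
    Target N = Perfect N × N ∋ e × N ∋ f

    avoids? : ∀ v → Dec (inc e v + inc f v ≡ 0)
    avoids? v = inc e v + inc f v ℕ.≟ 0

    W : Subset ∣V∣
    W = filter avoids?

    W-complement : ∀ v → χ W v + (inc e v + inc f v) ≡ 1
    W-complement v with avoids? v
    ... | yes ≡0 = cong₂ _+_ (χ-∋ (filter⁺ avoids? ≡0)) ≡0
    ... | no  ≢0 = cong₂ _+_ (χ-∌ (filter-∌ avoids? ≢0)) (≤-antisym (disjoint v) (n≢0⇒n>0 ≢0))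

    W-size : ∣ W ∣ + 4 ≡ ∣V∣
    W-size = begin
      ∣ W ∣ + 4                                      ≡⟨ cong₂ _+_ (∣∣≡sum W) (sym (trans (∑-distrib-+ (inc e) (inc f)) (cong₂ _+_ (sum-inc e) (sum-inc f)))) ⟩
      sum (χ W) + sum (λ v → inc e v + inc f v)      ≡⟨ sym (∑-distrib-+ (χ W) (λ v → inc e v + inc f v)) ⟩
      sum (λ v → χ W v + (inc e v + inc f v))        ≡⟨ sum-cong-≗ W-complement ⟩
      sum {∣V∣} (λ _ → 1)                            ≡⟨ trans (sum-const ∣V∣ 1) (*-identityʳ ∣V∣) ⟩
      ∣V∣                                            ∎
      where open ≡-Reasoning

    end-∉W : ∀ {v} → 1 ≤ inc e v + inc f v → W ∌ v
    end-∉W end = filter-∌ avoids? λ ≡0 → contradiction (≤-trans end (≤-reflexive ≡0)) λ ()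

    -- The size bound forces `M` to cover every vertex of `W`; the remaining vertices are the ends
    -- of `e` and `f`.
    complete : ∀ {M} → IsMatching W M → ∣ W ∣ ≤ ∣ M ∣ * 2 → ∃[ N ] Target N
    complete {M} matching full = M ⊕ e ⊕ f , target , trans (⊕-other (M ⊕ e) e≢f) (⊕-∋ M e) , ⊕-∋ (M ⊕ e) f
      where
      e≢f : e ≢ f
      e≢f refl = contradiction (≤-trans (+-mono-≤ (inc-src e) (inc-src e)) (disjoint (src e))) λ { (s≤s ()) }
      deg≡ : ∀ v → χ W v ≡ deg (χ M) v
      deg≡ = sum-squeeze matching (≤-trans (≤-reflexive (sym (∣∣≡sum W))) (≤-trans full (≤-reflexive (sym (degree-sum M)))))
      M∌e : M ∌ e
      M∌e = ⊕-fresh M (inc-src e) (trans (sym (deg≡ (src e))) (χ-∌ (end-∉W (≤-trans (inc-src e) (m≤m+n _ _)))))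
      M⊕e∌f : M ⊕ e ∌ f
      M⊕e∌f = trans (⊕-other M (e≢f ∘ sym)) (⊕-fresh M (inc-src f) (trans (sym (deg≡ (src f))) (χ-∌ (end-∉W (≤-trans (inc-src f) (m≤n+m _ (inc e (src f))))))))
      target : Perfect (M ⊕ e ⊕ f)
      target v = begin
        deg (χ (M ⊕ e ⊕ f)) v             ≡⟨ deg-⊕ (M ⊕ e) M⊕e∌f v ⟩
        deg (χ (M ⊕ e)) v + inc f v       ≡⟨ cong (_+ inc f v) (deg-⊕ M M∌e v) ⟩
        deg (χ M) v + inc e v + inc f v   ≡⟨ +-assoc (deg (χ M) v) (inc e v) (inc f v) ⟩
        deg (χ M) v + (inc e v + inc f v) ≡⟨ cong (_+ (inc e v + inc f v)) (sym (deg≡ v)) ⟩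
        χ W v + (inc e v + inc f v)       ≡⟨ W-complement v ⟩
        1                                 ∎
        where open ≡-Reasoning

    -- Here `∁ U` is the set A of the Tutte-Berge theorem and the classes of the roots are the odd
    -- sets attached to it.
    module Obstruction (U : Subset ∣V∣) (M : EdgeSet) (U⊆W : ∀ v → U ∋ v → W ∋ v)
                       (maximum : IsMaximum U M) (critical : ∀ v → U ∋ v → Missable U ∣ M ∣ v)
                       (few : ∣ ∁ U ∣ ≤ ∣ Classes.roots G U M maximum critical ∣ + 2) where
      open Classes G U M maximum critical

      ω : Edge → ℕ
      ω = off-weight P

      -- Equal to 2 on the path edges and 0 elsewhere: the ends that path edges contribute to `∁ U`.
      D : Edge → ℕ
      D q = δ e q * 2 + δ h q * 2 + δ f q * 2

      pathEdge-outside : ∀ {q} → q ≡ e ⊎ q ≡ h ⊎ q ≡ f → ∀ v → 1 ≤ inc q v → U ∌ v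
      pathEdge-outside q∈ v qv with ∋? U v
      ... | inj₂ U∌v = U∌v
      ... | inj₁ U∋v = ⊥-elim (∋-∌ (U⊆W v U∋v) (end-∉W (end q∈)))
        where
        end : _ → 1 ≤ inc e v + inc f v
        end (inj₁ refl)        = ≤-trans qv (m≤m+n _ _)
        end (inj₂ (inj₁ refl)) = joins v qv
        end (inj₂ (inj₂ refl)) = ≤-trans qv (m≤n+m _ (inc e v))

      D-zero : ∀ q v → 1 ≤ inc q v → U ∋ v → D q ≡ 0
      D-zero q v qv U∋v = cong₂ _+_ (cong₂ _+_ (vanish (inj₁ refl)) (vanish (inj₂ (inj₁ refl)))) (vanish (inj₂ (inj₂ refl)))
        where
        off : ∀ {p} → p ≡ e ⊎ p ≡ h ⊎ p ≡ f → p ≢ q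
        off p∈ refl = ∋-∌ U∋v (pathEdge-outside p∈ v qv)
        vanish : ∀ {p} → p ≡ e ⊎ p ≡ h ⊎ p ≡ f → δ p q * 2 ≡ 0
        vanish p∈ = cong (_* 2) (δ-≢ (off p∈))

      D≤2 : ∀ q → D q ≤ 2
      D≤2 q with e ≟ q | h ≟ q | f ≟ q
      ... | yes refl | yes refl | _        = contradiction refl e≢h
      ... | yes refl | no  _    | yes refl = contradiction (≤-trans (+-mono-≤ (inc-src e) (inc-src e)) (disjoint (src e))) λ { (s≤s ()) }
      ... | no  _    | yes refl | yes refl = contradiction refl f≢h
      ... | yes _    | no  _    | no  _    = ≤-refl
      ... | no  _    | yes _    | no  _    = ≤-refl
      ... | no  _    | no  _    | yes _    = ≤-refl
      ... | no  _    | no  _    | no  _    = z≤n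

      cuts : Edge → ℕ
      cuts q = sum λ r → χ roots r * χ (cut (class r)) q

      no-cuts : ∀ q → (∀ r → cut (class r) ∌ q) → cuts q ≡ 0
      no-cuts q uncut = sum-zero _ λ r → trans (cong (χ roots r *_) (χ-∌ (uncut r))) (*-zeroʳ (χ roots r))

      -- An edge with both ends in `∁ U` is cut by no class and can pay for `D`. An edge with one
      -- end there is not on the path and is cut by at most one class. An edge inside `U` is neither
      -- cut nor on the path.
      ends-bound : ∀ q → cuts q + D q ≤ endsIn (∁ U) q
      ends-bound q with ∋? U (src q) | ∋? U (tgt q)
      ... | inj₂ U∌s | inj₂ U∌t = ≤-trans (+-mono-≤ (≤-reflexive (no-cuts q λ r → outer-edge-uncut r q U∌s U∌t)) (D≤2 q))
                                          (≤-reflexive (sym (cong₂ _+_ (χ-∋ (∁-∋ U U∌s)) (χ-∋ (∁-∋ U U∌t)))))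
      ... | inj₁ U∋s | inj₁ U∋t = ≤-trans (≤-reflexive (cong₂ _+_ (no-cuts q λ r → inner-edge-uncut r q U∋s U∋t) (D-zero q (src q) (inc-src q) U∋s))) z≤n
      ... | inj₁ U∋s | inj₂ U∌t = ≤-trans (+-mono-≤ (cuts-at q (inj₂ U∌t)) (≤-reflexive (D-zero q (src q) (inc-src q) U∋s)))
                                          (≤-reflexive (sym (cong₂ _+_ (χ-∌ (∁-∌ U U∋s)) (χ-∋ (∁-∋ U U∌t)))))
      ... | inj₂ U∌s | inj₁ U∋t = ≤-trans (+-mono-≤ (cuts-at q (inj₁ U∌s)) (≤-reflexive (D-zero q (tgt q) (inc-tgt q) U∋t)))
                                          (≤-reflexive (sym (cong₂ _+_ (χ-∋ (∁-∋ U U∌s)) (χ-∌ (∁-∌ U U∋t)))))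

      ω≡2 : ∀ {q} → P ∌ q → ω q ≡ 2
      ω≡2 P∌q = cong suc (χ-∋ (∁-∋ P P∌q))

      -- Each of the three path edges avoids `P`, hence has weight 2, and contributes 2 times 2.
      weighted-D : sum (λ q → ω q * D q) ≡ 12
      weighted-D = begin
        sum (λ q → ω q * D q)
          ≡⟨ sum-cong-≗ (λ q → trans (*-distribˡ-+ (ω q) (δ e q * 2 + δ h q * 2) (δ f q * 2))
                               (cong₂ _+_ (trans (*-distribˡ-+ (ω q) (δ e q * 2) (δ h q * 2)) (cong₂ _+_ (*-swap (ω q) (δ e q) 2) (*-swap (ω q) (δ h q) 2)))
                                          (*-swap (ω q) (δ f q) 2))) ⟩
        sum (λ q → δ e q * (ω q * 2) + δ h q * (ω q * 2) + δ f q * (ω q * 2))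
          ≡⟨ ∑-distrib-+ (λ q → δ e q * (ω q * 2) + δ h q * (ω q * 2)) (λ q → δ f q * (ω q * 2)) ⟩
        sum (λ q → δ e q * (ω q * 2) + δ h q * (ω q * 2)) + sum (λ q → δ f q * (ω q * 2))
          ≡⟨ cong (_+ sum (λ q → δ f q * (ω q * 2))) (∑-distrib-+ (λ q → δ e q * (ω q * 2)) (λ q → δ h q * (ω q * 2))) ⟩
        sum (λ q → δ e q * (ω q * 2)) + sum (λ q → δ h q * (ω q * 2)) + sum (λ q → δ f q * (ω q * 2))
          ≡⟨ cong₂ _+_ (cong₂ _+_ (single e P∌e) (single h P∌h)) (single f P∌f) ⟩
        12 ∎
        where
        open ≡-Reasoning
        single : ∀ p → P ∌ p → sum (λ q → δ p q * (ω q * 2)) ≡ 4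
        single p P∌p = trans (sum-δ p (λ q → ω q * 2)) (cong (_* 2) (ω≡2 P∌p))

      weighted-cuts : sum (λ q → ω q * cuts q) ≡ sum (λ r → χ roots r * weight ω (cut (class r)))
      weighted-cuts = begin
        sum (λ q → ω q * cuts q)                                                     ≡⟨ sum-cong-≗ (λ q → *-distribˡ-sum (ω q) (λ r → χ roots r * χ (cut (class r)) q)) ⟩
        sum (λ q → sum (λ r → ω q * (χ roots r * χ (cut (class r)) q)))              ≡⟨ ∑-comm (λ q r → ω q * (χ roots r * χ (cut (class r)) q)) ⟩
        sum (λ r → sum (λ q → ω q * (χ roots r * χ (cut (class r)) q)))              ≡⟨ sum-cong-≗ (λ r → sum-cong-≗ λ q → *-swap (ω q) (χ roots r) (χ (cut (class r)) q)) ⟩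
        sum (λ r → sum (λ q → χ roots r * (ω q * χ (cut (class r)) q)))              ≡⟨ sum-cong-≗ (λ r → sym (*-distribˡ-sum (χ roots r) (λ q → ω q * χ (cut (class r)) q))) ⟩
        sum (λ r → χ roots r * weight ω (cut (class r)))                             ∎
        where open ≡-Reasoning

      U≤W : ∣ U ∣ ≤ ∣ W ∣
      U≤W = ∣∣-mono U W λ v → le v (∋? U v)
        where
        le : ∀ v → U ∋ v ⊎ U ∌ v → χ U v ≤ χ W v
        le v (inj₁ U∋v) = ≤-reflexive (trans (χ-∋ U∋v) (sym (χ-∋ (U⊆W v U∋v))))
        le v (inj₂ U∌v) = ≤-trans (≤-reflexive (χ-∌ U∌v)) z≤n

      class≤U : ∀ r → ∣ class r ∣ ≤ ∣ U ∣
      class≤U r = ∣∣-mono (class r) U λ v → le v (∋? (class r) v)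
        where
        le : ∀ v → class r ∋ v ⊎ class r ∌ v → χ (class r) v ≤ χ U v
        le v (inj₁ r∋v) = ≤-reflexive (trans (χ-∋ r∋v) (sym (χ-∋ (proj₁ (class⁻ r∋v)))))
        le v (inj₂ r∌v) = ≤-trans (≤-reflexive (χ-∌ r∌v)) z≤n

      -- The class lies inside `W`, which omits the four ends of `e` and `f`.
      ∁class≥4 : ∀ r → 4 ≤ ∣ ∁ (class r) ∣
      ∁class≥4 r = +-cancelˡ-≤ (∣ class r ∣) 4 _ (≤-trans (+-monoˡ-≤ 4 (≤-trans (class≤U r) U≤W)) (≤-reflexive (trans W-size (sym (∣∣+∣∁∣ (class r))))))

      cuts-heavy : ∣ roots ∣ * 5 ≤ sum (λ r → χ roots r * weight ω (cut (class r)))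
      cuts-heavy = ≤-trans (≤-reflexive (sym (sum-regular roots λ _ _ → refl))) (sum-mono λ r → le r (∋? roots r))
        where
        le : ∀ r → roots ∋ r ⊎ roots ∌ r → χ roots r * 5 ≤ χ roots r * weight ω (cut (class r))
        le r (inj₁ R∋r) = *-monoʳ-≤ (χ roots r) (odd-cut-weight {P} perfect (class r) (weight (χ M) (inner (class r))) (class-odd R∋r) (∁class≥4 r))
        le r (inj₂ R∌r) = ≤-trans (≤-reflexive (cong (_* 5) (χ-∌ R∌r))) z≤n

      -- The weighted ends in `∁ U` number `∣ ∁ U ∣ * 5`. By `ends-bound` they pay 5 for each root
      -- and 12 for the path, while `few` allows only 10 beyond the roots.
      impossible : ⊥
      impossible = count (∣ ∁ U ∣) (∣ roots ∣) few (begin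
        ∣ roots ∣ * 5 + 12                                                             ≤⟨ +-monoˡ-≤ 12 cuts-heavy ⟩
        sum (λ r → χ roots r * weight ω (cut (class r))) + 12                          ≡⟨ cong₂ _+_ (sym weighted-cuts) (sym weighted-D) ⟩
        sum (λ q → ω q * cuts q) + sum (λ q → ω q * D q)                               ≡⟨ sym (∑-distrib-+ (λ q → ω q * cuts q) (λ q → ω q * D q)) ⟩
        sum (λ q → ω q * cuts q + ω q * D q)                                           ≤⟨ sum-mono (λ q → ≤-trans (≤-reflexive (sym (*-distribˡ-+ (ω q) (cuts q) (D q)))) (*-monoʳ-≤ (ω q) (ends-bound q))) ⟩
        sum (λ q → ω q * endsIn (∁ U) q)                                               ≡⟨ sym (handshake ω (χ (∁ U))) ⟩
        sum (λ v → χ (∁ U) v * deg ω v)                                                ≡⟨ sum-regular (∁ U) (λ v _ → off-weight-deg {P} perfect v) ⟩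
        ∣ ∁ U ∣ * 5                                                                    ∎)
        where
        open ≤-Reasoning
        count : ∀ a r → a ≤ r + 2 → r * 5 + 12 ≤ a * 5 → ⊥
        count a r a≤ le = 1+n≰n {r * 5 + 11} (≤-trans (≤-reflexive (sym (+-suc (r * 5) 11))) (≤-trans le (≤-trans (*-monoˡ-≤ 5 a≤) (≤-trans (≤-reflexive (*-distribʳ-+ 5 r 2)) (+-monoʳ-≤ (r * 5) (n≤1+n 10))))))

    -- If a maximum matching of `W` does not cover `W`, passing to a critical subset bounds
    -- `∣ ∁ U ∣` through `deficiency`, and the obstruction is contradictory.
    extension : ∃[ N ] Target N
    extension with maximum-exists W
    ... | M₀ , max₀@(matching₀ , _) with ∣ W ∣ ≤? ∣ M₀ ∣ * 2
    ...   | yes full = complete {M₀} matching₀ full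
    ...   | no  short with critical-subset _ W M₀ ≤-refl max₀
    ...     | U , M , U⊆W , maximum , sizes , critical = ⊥-elim (Obstruction.impossible U M U⊆W maximum critical few)
      where
      open Classes G U M maximum critical using (roots; roots-count)
      few : ∣ ∁ U ∣ ≤ ∣ roots ∣ + 2
      few = deficiency (∣ W ∣) (∣ M₀ ∣) (∣ M ∣) (∣ ∁ U ∣) (∣ roots ∣) (∣ P ∣)
        (≤-trans sizes (≤-reflexive (cong (_+ ∣ M₀ ∣) (sym roots-count))))
        (trans (cong (∣ ∁ U ∣ +_) roots-count) (trans (+-comm (∣ ∁ U ∣) (∣ U ∣)) (trans (∣∣+∣∁∣ U) (sym W-size))))
        (≰⇒> short) (trans W-size (perfect-size {P} perfect))

-- Duplicate-free lists in finite sets.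

unique-length : (S : Subset n) (is : List (Fin n)) → Unique is → All (S ∋_) is → length is ≤ ∣ S ∣
unique-length S []       []            []            = z≤n
unique-length S (i ∷ is) (i≢is ∷ uniq) (S∋i ∷ S∋is) = ≤-trans
  (s≤s (unique-length (S ⊖ i) is uniq (All.zipWith (λ { (i≢j , S∋j) → trans (⊖-other S (i≢j ∘ sym)) S∋j }) (i≢is , S∋is))))
  (≤-reflexive (sym (∣⊖∣ S S∋i)))

-- An element of `S` outside the list would extend it to a duplicate-free list longer than `∣ S ∣`.
unique-exhausts : (S : Subset n) (is : List (Fin n)) → Unique is → All (S ∋_) is → ∣ S ∣ ≤ length is → ∀ {i} → S ∋ i → i List.∈ is
unique-exhausts S is uniq S∋is S≤is {i} S∋i with DecMembership._∈?_ _≟_ i is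
... | yes i∈is = i∈is
... | no  i∉is = contradiction (≤-trans (unique-length S (i ∷ is) (¬Any⇒All¬ is i∉is ∷ uniq) (S∋i ∷ S∋is)) S≤is) 1+n≰n

-- Ends of edges; absence of loops and triangles.

module Joining (G : Graph) (cubic : Cubic G) (connected : CyclicallyEdgeConnected G 4)
               {P : Graph.EdgeSet G} (perfect : Extension.Perfect G cubic connected P) where
  open Graph G
  open Incidence G
  open Circuits G
  open Matchings G
  open Extension G cubic connected

  -- A perfect matching makes the number of vertices even. The two excluded values are those that
  -- would leave too small a complement for `small-cut` when `X` is a vertex or a triangle.
  even-order : ∀ X k → ∣ X ∣ ≡ suc (k * 2) → ∣ ∁ X ∣ ≢ 0 × ∣ ∁ X ∣ ≢ 2
  even-order X k odd = (λ ≡0 → double≢odd (∣ P ∣) k (trans total (trans (cong (suc (k * 2) +_) ≡0) (+-identityʳ _)))) ,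
                       (λ ≡2 → double≢odd (∣ P ∣) (suc k) (trans total (trans (cong (suc (k * 2) +_) ≡2) (+-comm (suc (k * 2)) 2))))
    where
    total : ∣ P ∣ * 2 ≡ suc (k * 2) + ∣ ∁ X ∣
    total = trans (sym (perfect-size {P} perfect)) (trans (sym (∣∣+∣∁∣ X)) (cong (_+ ∣ ∁ X ∣) odd))

  -- A loop leaves at most one cut edge at its vertex, and the complement of that vertex is nonempty
  -- by parity, so `small-cut` applies.
  no-loop : ∀ e → src e ≢ tgt e
  no-loop e s≡t = small-cut connected cubic X (≤-trans (s≤s cut≤1) (s≤s (s≤s z≤n))) (≤-reflexive (sym ∣X∣)) (≤-trans cut≤1 (≤-reflexive (sym ∣X∣)))
                    ∁X≥1 (≤-trans cut≤1 ∁X≥1)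
    where
    X : Subset ∣V∣
    X = ∅ ⊕ src e
    ∣X∣ : ∣ X ∣ ≡ 1
    ∣X∣ = ∣∅⊕∣ (src e)
    ∁X≥1 : 1 ≤ ∣ ∁ X ∣
    ∁X≥1 = n≢0⇒n>0 (proj₁ (even-order X 0 ∣X∣))
    inner≥1 : 1 ≤ ∣ inner X ∣
    inner≥1 = ∋⇒1≤∣∣ (inner X) (trans (inner-lookup X e) (cong₂ _∧_ (⊕-∋ ∅ (src e)) (trans (cong (lookup X) (sym s≡t)) (⊕-∋ ∅ (src e)))))
    cut≤1 : ∣ cut X ∣ ≤ 1
    cut≤1 = count (∣ cut X ∣) (∣ inner X ∣) inner≥1 (trans (sym (cubic-volume cubic X)) (cong (_* 3) ∣X∣))
      where
      count : ∀ c i → 1 ≤ i → c + 2 * i ≡ 3 → c ≤ 1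
      count c i i≥1 eq = +-cancelʳ-≤ 2 c 1 (≤-trans (+-monoʳ-≤ c (*-monoʳ-≤ 2 i≥1)) (≤-reflexive eq))

  -- Stated through `inc` rather than `ends`, so that the order of the ends is irrelevant and
  -- exchanges of edges reduce to cancelling deltas.
  record Joins (e : Edge) (p q : Vertex) : Set where
    constructor joining
    field inc-joins : ∀ w → inc e w ≡ δ p w + δ q w
  open Joins

  joins-left : ∀ {e p q} → Joins e p q → 1 ≤ inc e p
  joins-left {e} {p} {q} j = ≤-trans (≤-trans (≤-reflexive (sym (δ-refl p))) (m≤m+n _ _)) (≤-reflexive (sym (inc-joins j p)))

  joins-right : ∀ {e p q} → Joins e p q → 1 ≤ inc e q
  joins-right {e} {p} {q} j = ≤-trans (≤-trans (≤-reflexive (sym (δ-refl q))) (m≤n+m _ (δ p q))) (≤-reflexive (sym (inc-joins j q)))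

  joins-only : ∀ {e p q} → Joins e p q → ∀ {w} → 1 ≤ inc e w → w ≡ p ⊎ w ≡ q
  joins-only {e} {p} {q} j {w} ew with p ≟ w | q ≟ w | ≤-trans ew (≤-reflexive (inc-joins j w))
  ... | yes p≡w | _       | _ = inj₁ (sym p≡w)
  ... | no  _   | yes q≡w | _ = inj₂ (sym q≡w)

  other-end : ∀ {e p} → 1 ≤ inc e p → ∃[ q ] p ≢ q × Joins e p q
  other-end {e} {p} ep with inc-src-or-tgt e p ep
  ... | inj₁ refl = tgt e , no-loop e , joining (inc≡ e)
  ... | inj₂ refl = src e , no-loop e ∘ sym , joining λ w → trans (inc≡ e w) (+-comm (δ (src e) w) (δ (tgt e) w))

  joins : ∀ {e p q} → 1 ≤ inc e p → 1 ≤ inc e q → p ≢ q → Joins e p q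
  joins {e} {p} {q} ep eq p≢q with other-end {e} {p} ep
  ... | q′ , _ , j with joins-only {e} {p} {q′} j {q} eq
  ... | inj₁ q≡p  = contradiction (sym q≡p) p≢q
  ... | inj₂ refl = j

  inc≤1 : ∀ e w → inc e w ≤ 1
  inc≤1 e w rewrite inc≡ e w with src e ≟ w | tgt e ≟ w
  ... | yes s≡w | yes t≡w = contradiction (trans s≡w (sym t≡w)) (no-loop e)
  ... | yes _   | no  _   = ≤-refl
  ... | no  _   | yes _   = ≤-refl
  ... | no  _   | no  _   = z≤n

  inner⁺ : ∀ X {e p q} → Joins e p q → X ∋ p → X ∋ q → inner X ∋ e
  inner⁺ X {e} {p} {q} j X∋p X∋q = trans (inner-lookup X e) (cong₂ _∧_ (member (joins-only {e} j (inc-src e))) (member (joins-only {e} j (inc-tgt e))))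
    where
    member : ∀ {w} → w ≡ p ⊎ w ≡ q → X ∋ w
    member (inj₁ refl) = X∋p
    member (inj₂ refl) = X∋q

  -- The three inner edges leave a cut of at most three. The two vertices `v` and `w` outside force
  -- a third one by parity, so both sides are large enough for `small-cut`.
  no-triangle : ∀ {a b h u x y v w} → u ≢ x → u ≢ y → x ≢ y → Joins a u x → Joins b u y → Joins h x y →
                v ≢ u → v ≢ x → v ≢ y → w ≢ u → w ≢ x → w ≢ y → v ≢ w → ⊥
  no-triangle {a} {b} {h} {u} {x} {y} {v} {w} u≢x u≢y x≢y ja jb jh v≢u v≢x v≢y w≢u w≢x w≢y v≢w =
    small-cut connected cubic X (s≤s cut≤3) (≤-trans (s≤s z≤n) (≤-reflexive (sym ∣X∣))) (≤-trans cut≤3 (≤-reflexive (sym ∣X∣)))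
      (≤-trans (s≤s z≤n) ∁X≥2) (≤-trans cut≤3 (≤∧≢⇒< ∁X≥2 (proj₂ (even-order X 1 ∣X∣) ∘ sym)))
    where
    X : Subset ∣V∣
    X = ∅ ⊕ u ⊕ x ⊕ y
    ∅∌ : ∀ {z} → ∅ {∣V∣} ∌ z
    ∅∌ {z} = ∅-∌ z
    X∋y : X ∋ y
    X∋y = ⊕-∋ (∅ ⊕ u ⊕ x) y
    X∋x : X ∋ x
    X∋x = trans (⊕-other (∅ ⊕ u ⊕ x) x≢y) (⊕-∋ (∅ ⊕ u) x)
    X∋u : X ∋ u
    X∋u = trans (⊕-other (∅ ⊕ u ⊕ x) u≢y) (trans (⊕-other (∅ ⊕ u) u≢x) (⊕-∋ ∅ u))
    X∌ : ∀ {z} → z ≢ u → z ≢ x → z ≢ y → X ∌ z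
    X∌ {z} z≢u z≢x z≢y = trans (⊕-other (∅ ⊕ u ⊕ x) z≢y) (trans (⊕-other (∅ ⊕ u) z≢x) (trans (⊕-other ∅ z≢u) ∅∌))
    ∣X∣ : ∣ X ∣ ≡ 3
    ∣X∣ = trans (∣⊕∣ (∅ ⊕ u ⊕ x) (trans (⊕-other (∅ ⊕ u) (x≢y ∘ sym)) (trans (⊕-other ∅ (u≢y ∘ sym)) ∅∌)))
            (cong suc (trans (∣⊕∣ (∅ ⊕ u) (trans (⊕-other ∅ (u≢x ∘ sym)) ∅∌)) (cong suc (∣∅⊕∣ u))))
    ∁X≥2 : 2 ≤ ∣ ∁ X ∣
    ∁X≥2 = unique-length (∁ X) (v ∷ w ∷ []) ((v≢w ∷ []) ∷ [] ∷ []) (∁-∋ X (X∌ v≢u v≢x v≢y) ∷ ∁-∋ X (X∌ w≢u w≢x w≢y) ∷ [])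
    differ : ∀ {e f z} → 1 ≤ inc e z → ¬ 1 ≤ inc f z → e ≢ f
    differ ez fz refl = fz ez
    misses : ∀ {e p q z} → Joins e p q → z ≢ p → z ≢ q → ¬ 1 ≤ inc e z
    misses {e} j z≢p z≢q ez with joins-only {e} j ez
    ... | inj₁ z≡p = z≢p z≡p
    ... | inj₂ z≡q = z≢q z≡q
    a≢b : a ≢ b
    a≢b = differ (joins-right {a} ja) (misses {b} jb (u≢x ∘ sym) x≢y)
    a≢h : a ≢ h
    a≢h = differ (joins-left {a} ja) (misses {h} jh u≢x u≢y)
    b≢h : b ≢ h
    b≢h = differ (joins-left {b} jb) (misses {h} jh u≢x u≢y)
    inner≥3 : 3 ≤ ∣ inner X ∣
    inner≥3 = unique-length (inner X) (a ∷ b ∷ h ∷ []) ((a≢b ∷ a≢h ∷ []) ∷ (b≢h ∷ []) ∷ [] ∷ [])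
                (inner⁺ X {a} ja X∋u X∋x ∷ inner⁺ X {b} jb X∋u X∋y ∷ inner⁺ X {h} jh X∋x X∋y ∷ [])
    cut≤3 : ∣ cut X ∣ ≤ 3
    cut≤3 = +-cancelʳ-≤ 6 (∣ cut X ∣) 3 (≤-trans (+-monoʳ-≤ (∣ cut X ∣) (*-monoʳ-≤ 2 inner≥3)) (≤-reflexive (trans (sym (cubic-volume cubic X)) (cong (_* 3) ∣X∣))))

-- Triples of perfect matchings and their missed edges.

deg-positive : (G : Graph) → let open Incidence G in ∀ ω v → 1 ≤ deg ω v → ∃[ e ] 1 ≤ ω e × 1 ≤ inc e v
deg-positive G ω v le with any? (λ e → (1 ≤? ω e) ×-dec (1 ≤? Incidence.inc G e v))
... | yes found = found
... | no  none  = contradiction (≤-trans le (≤-reflexive (sum-zero _ zeros))) λ ()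
  where
  open Incidence G
  zeros : ∀ e → ω e * inc e v ≡ 0
  zeros e with 1 ≤? ω e | 1 ≤? inc e v
  ... | no ω≱1 | _       = cong (_* inc e v) (n≤0⇒n≡0 (≤-pred (≰⇒> ω≱1)))
  ... | yes _  | no i≱1  = trans (cong (ω e *_) (n≤0⇒n≡0 (≤-pred (≰⇒> i≱1)))) (*-zeroʳ (ω e))
  ... | yes p  | yes q   = contradiction (e , p , q) none

module Triple (G : Graph) (cubic : Cubic G) (connected : CyclicallyEdgeConnected G 4) where
  open Graph G
  open Incidence G
  open Circuits G
  open Matchings G
  open Extension G cubic connected

  cover : EdgeSet → EdgeSet → EdgeSet → Edge → ℕ
  cover A B C e = χ A e + χ B e + χ C e

  opaque
    missed : EdgeSet → EdgeSet → EdgeSet → EdgeSet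
    missed A B C = ∁ (A ∪ B ∪ C)

    missed≡ : ∀ A B C → missed A B C ≡ ∁ (A ∪ B ∪ C)
    missed≡ A B C = refl

  missed-lookup : ∀ A B C e → lookup (missed A B C) e ≡ not (lookup A e ∨ (lookup B e ∨ lookup C e))
  missed-lookup A B C e = trans (cong (λ S → lookup S e) (missed≡ A B C)) (trans (∁-lookup (A ∪ B ∪ C) e) (cong not (trans (lookup-zipWith _∨_ e A (B ∪ C)) (cong (lookup A e ∨_) (lookup-zipWith _∨_ e B C)))))

  missed⁻ : ∀ A B C {e} → missed A B C ∋ e → A ∌ e × B ∌ e × C ∌ e
  missed⁻ A B C {e} p with lookup A e | lookup B e | lookup C e | trans (sym (missed-lookup A B C e)) p
  ... | false | false | false | _ = refl , refl , refl

  missed⁺ : ∀ A B C {e} → A ∌ e → B ∌ e → C ∌ e → missed A B C ∋ e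
  missed⁺ A B C {e} A∌e B∌e C∌e = trans (missed-lookup A B C e) (cong not (cong₂ _∨_ A∌e (cong₂ _∨_ B∌e C∌e)))

  -- Truth table for one edge when the first matching is replaced: an edge dropped from it stays
  -- covered if it was covered twice.
  keeps : ∀ a b c n → (a ≡ true → n ≡ true ⊎ 2 ≤ bit a + bit b + bit c) → a ∨ (b ∨ c) ≡ true → n ∨ (b ∨ c) ≡ true
  keeps a     b     c     true  _ _ = refl
  keeps true  true  c     false _ _ = refl
  keeps true  false true  false _ _ = refl
  keeps false b     c     false _ p = p
  keeps true  false false false h _ with h refl
  ... | inj₁ ()
  ... | inj₂ (s≤s ())

  module Optimal (A B C : EdgeSet) (A-perfect : Perfect A) (B-perfect : Perfect B) (C-perfect : Perfect C)
                 (optimal : ∀ A′ B′ C′ → Perfect A′ → Perfect B′ → Perfect C′ → ∣ missed A B C ∣ ≤ ∣ missed A′ B′ C′ ∣) where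

    -- The edges of `A` absent from `N` remain covered by `B` or `C`, so replacing `A` by `N` misses
    -- nothing new. Covering `a` as well would contradict optimality.
    replace : ∀ N → Perfect N → (∀ e → A ∋ e → N ∋ e ⊎ 2 ≤ cover A B C e) → ∀ a → missed A B C ∋ a → N ∌ a
    replace N N-perfect keep a missed∋a with ∋? N a
    ... | inj₂ N∌a = N∌a
    ... | inj₁ N∋a = contradiction (≤-trans (s≤s fewer) (≤-trans (≤-reflexive (sym (∣⊖∣ (missed A B C) missed∋a))) (optimal N B C N-perfect B-perfect C-perfect))) 1+n≰n
      where
      fewer : ∣ missed N B C ∣ ≤ ∣ missed A B C ⊖ a ∣
      fewer = ∣∣-mono (missed N B C) (missed A B C ⊖ a) λ e → le e (∋? (missed N B C) e)
        where
        still : ∀ {e} → missed N B C ∋ e → missed A B C ∋ e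
        still {e} p with ∋? A e
        ... | inj₂ A∌e = let _ , B∌e , C∌e = missed⁻ N B C p in missed⁺ A B C A∌e B∌e C∌e
        ... | inj₁ A∋e = ⊥-elim (∋-∌ (trans (sym (cong not (keeps (lookup A e) (lookup B e) (lookup C e) (lookup N e) (keep e) (cong (_∨ (lookup B e ∨ lookup C e)) A∋e))) ) (trans (sym (missed-lookup N B C e)) p)) refl)
        le : ∀ e → missed N B C ∋ e ⊎ missed N B C ∌ e → χ (missed N B C) e ≤ χ (missed A B C ⊖ a) e
        le e (inj₂ ∌e) = ≤-trans (≤-reflexive (χ-∌ ∌e)) z≤n
        le e (inj₁ ∋e) = ≤-trans (χ≤1 (missed N B C) e) (≤-reflexive (sym (χ-∋ (⊖-∋⁺ (missed A B C) a≢e (still ∋e)))))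
          where
          a≢e : a ≢ e
          a≢e refl = ∋-∌ N∋a (proj₁ (missed⁻ N B C ∋e))

TwoMore : Subset n → Fin n → Fin n → Set
TwoMore S a b = ∃[ c ] ∃[ d ] (S ∋ c × S ∋ d) × (a ≢ c × a ≢ d) × (b ≢ c × b ≢ d) × c ≢ d

two-more : (S : Subset n) {a b : Fin n} → ∣ S ∣ ≡ 4 → S ∋ a → S ∋ b → a ≢ b → TwoMore S a b
two-more S {a} {b} ∣S∣ S∋a S∋b a≢b with ∃-∋ (S ⊖ a ⊖ b) (≤-trans (s≤s z≤n) (≤-reflexive (sym two-left)))
  where
  two-left : ∣ S ⊖ a ⊖ b ∣ ≡ 2
  two-left = suc-injective (suc-injective (trans (sym (trans (∣⊖∣ S S∋a) (cong suc (∣⊖∣ (S ⊖ a) (trans (⊖-other S (a≢b ∘ sym)) S∋b))))) ∣S∣))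
... | c , c∈ with ⊖-∋⁻ (S ⊖ a) c∈
... | b≢c , c∈′ with ⊖-∋⁻ S c∈′
... | a≢c , S∋c with ∃-∋ (S ⊖ a ⊖ b ⊖ c) (≤-reflexive (suc-injective (suc-injective (suc-injective (trans (sym ∣S∣) size)))))
  where
  size : ∣ S ∣ ≡ suc (suc (suc ∣ S ⊖ a ⊖ b ⊖ c ∣))
  size = trans (∣⊖∣ S S∋a) (cong suc (trans (∣⊖∣ (S ⊖ a) (trans (⊖-other S (a≢b ∘ sym)) S∋b)) (cong suc (∣⊖∣ (S ⊖ a ⊖ b) c∈))))
... | d , d∈ with ⊖-∋⁻ (S ⊖ a ⊖ b) d∈
... | c≢d , d∈′ with ⊖-∋⁻ (S ⊖ a) d∈′
... | b≢d , d∈″ with ⊖-∋⁻ S d∈″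
... | a≢d , S∋d = c , d , (S∋c , S∋d) , (a≢c , a≢d) , (b≢c , b≢d) , c≢d

-- The missed edges of an optimal triple with defect 4.

module Defect (G : Graph) (cubic : Cubic G) (connected : CyclicallyEdgeConnected G 4)
              (A B C : Graph.EdgeSet G)
              (A-perfect : Extension.Perfect G cubic connected A)
              (B-perfect : Extension.Perfect G cubic connected B)
              (C-perfect : Extension.Perfect G cubic connected C)
              (optimal : ∀ A′ B′ C′ → Extension.Perfect G cubic connected A′ → Extension.Perfect G cubic connected B′ →
                         Extension.Perfect G cubic connected C′ →
                         ∣ Triple.missed G cubic connected A B C ∣ ≤ ∣ Triple.missed G cubic connected A′ B′ C′ ∣)
              (∣missed∣ : ∣ Triple.missed G cubic connected A B C ∣ ≡ 4) where
  open Graph G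
  open Incidence G
  open Circuits G
  open Matchings G
  open Extension G cubic connected
  open Triple G cubic connected
  open Joining G cubic connected {A} A-perfect
  open Joins

  cov : Edge → ℕ
  cov = cover A B C

  U : EdgeSet
  U = missed A B C

  -- One of the three matchings, so that exchange arguments are given once for all of them.
  data Selected : EdgeSet → Set where
    first  : Selected A
    second : Selected B
    third  : Selected C

  selected-perfect : ∀ {X} → Selected X → Perfect X
  selected-perfect first  = A-perfect
  selected-perfect second = B-perfect
  selected-perfect third  = C-perfect

  missed-∌ : ∀ {X e} → Selected X → U ∋ e → X ∌ e
  missed-∌ first  U∋e = proj₁ (missed⁻ A B C U∋e)
  missed-∌ second U∋e = proj₁ (proj₂ (missed⁻ A B C U∋e))
  missed-∌ third  U∋e = proj₂ (proj₂ (missed⁻ A B C U∋e))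

  covering : ∀ e → 1 ≤ cov e → ∃[ X ] Selected X × X ∋ e
  covering e le with ∋? A e | ∋? B e | ∋? C e
  ... | inj₁ p | _      | _      = A , first , p
  ... | inj₂ _ | inj₁ p | _      = B , second , p
  ... | inj₂ _ | inj₂ _ | inj₁ p = C , third , p
  ... | inj₂ p | inj₂ q | inj₂ r = contradiction (≤-trans le (≤-reflexive (cong₂ _+_ (cong₂ _+_ (χ-∌ p) (χ-∌ q)) (χ-∌ r)))) λ ()

  avoiding : ∀ e → cov e ≢ 3 → ∃[ X ] Selected X × X ∌ e
  avoiding e ≢3 with ∋? A e | ∋? B e | ∋? C e
  ... | inj₂ p | _      | _      = A , first , p
  ... | inj₁ _ | inj₂ p | _      = B , second , p
  ... | inj₁ _ | inj₁ _ | inj₂ p = C , third , p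
  ... | inj₁ p | inj₁ q | inj₁ r = contradiction (cong₂ _+_ (cong₂ _+_ (χ-∋ p) (χ-∋ q)) (χ-∋ r)) ≢3

  triple-∋ : ∀ {X e} → Selected X → cov e ≡ 3 → X ∋ e
  triple-∋ {X} {e} sel ≡3 with ∋? X e
  ... | inj₁ p = p
  ... | inj₂ X∌e = contradiction (bound sel X∌e) (λ le → 1+n≰n (≤-trans (≤-reflexive (sym ≡3)) le))
    where
    bound : ∀ {X} → Selected X → X ∌ e → cov e ≤ 2
    bound first  p = +-mono-≤ (+-mono-≤ (≤-reflexive (χ-∌ p)) (χ≤1 B e)) (χ≤1 C e)
    bound second p = +-mono-≤ (+-mono-≤ (χ≤1 A e) (≤-reflexive (χ-∌ p))) (χ≤1 C e)
    bound third  p = +-mono-≤ (+-mono-≤ (χ≤1 A e) (χ≤1 B e)) (≤-reflexive (χ-∌ p))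

  ∨-swap₁ : ∀ a b c → b ∨ (a ∨ c) ≡ a ∨ (b ∨ c)
  ∨-swap₁ true  true  c = refl
  ∨-swap₁ true  false c = refl
  ∨-swap₁ false true  c = refl
  ∨-swap₁ false false c = refl

  ∨-swap₂ : ∀ a b c → c ∨ (b ∨ a) ≡ a ∨ (b ∨ c)
  ∨-swap₂ true  true  true  = refl
  ∨-swap₂ true  true  false = refl
  ∨-swap₂ true  false true  = refl
  ∨-swap₂ true  false false = refl
  ∨-swap₂ false true  true  = refl
  ∨-swap₂ false true  false = refl
  ∨-swap₂ false false true  = refl
  ∨-swap₂ false false false = refl

  missed-BAC : ∀ e → lookup (missed B A C) e ≡ lookup U e
  missed-BAC e = trans (missed-lookup B A C e) (trans (cong not (∨-swap₁ (lookup A e) (lookup B e) (lookup C e))) (sym (missed-lookup A B C e)))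

  missed-CBA : ∀ e → lookup (missed C B A) e ≡ lookup U e
  missed-CBA e = trans (missed-lookup C B A e) (trans (cong not (∨-swap₂ (lookup A e) (lookup B e) (lookup C e))) (sym (missed-lookup A B C e)))

  -- Permuting the triple changes neither the set of missed edges nor the covering numbers, so the
  -- chosen matching may be moved to the first place.
  replace-selected : ∀ {X} → Selected X → ∀ N → Perfect N → (∀ e → X ∋ e → N ∋ e ⊎ 2 ≤ cov e) → ∀ a → U ∋ a → N ∌ a
  replace-selected first = Optimal.replace A B C A-perfect B-perfect C-perfect optimal
  replace-selected second N N-perfect keep a U∋a =
    Optimal.replace B A C B-perfect A-perfect C-perfect
      (λ A′ B′ C′ p q r → ≤-trans (∣∣-mono (missed B A C) U λ e → ≤-reflexive (cong bit (missed-BAC e))) (optimal A′ B′ C′ p q r))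
      N N-perfect (λ e B∋e → subst (λ k → N ∋ e ⊎ 2 ≤ k) (cong (_+ χ C e) (+-comm (χ A e) (χ B e))) (keep e B∋e))
      a (trans (missed-BAC a) U∋a)
  replace-selected third N N-perfect keep a U∋a =
    Optimal.replace C B A C-perfect B-perfect A-perfect
      (λ A′ B′ C′ p q r → ≤-trans (∣∣-mono (missed C B A) U λ e → ≤-reflexive (cong bit (missed-CBA e))) (optimal A′ B′ C′ p q r))
      N N-perfect (λ e C∋e → subst (λ k → N ∋ e ⊎ 2 ≤ k) (cover-CBA (χ A e) (χ B e) (χ C e)) (keep e C∋e))
      a (trans (missed-CBA a) U∋a)
    where
    cover-CBA : ∀ a b c → a + b + c ≡ c + b + a
    cover-CBA a b c = trans (+-comm (a + b) c) (trans (cong (c +_) (+-comm a b)) (sym (+-assoc c b a)))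

  -- The truncated subtraction gives missed edges excess 0; `missed+cov` makes up for the truncation
  -- by the summand `χ U e`.
  excess : Edge → ℕ
  excess e = cov e ∸ 1

  missed+cov : ∀ e → χ U e + cov e ≡ 1 + excess e
  missed+cov e rewrite missed-lookup A B C e = table (lookup A e) (lookup B e) (lookup C e)
    where
    table : ∀ a b c → bit (not (a ∨ (b ∨ c))) + (bit a + bit b + bit c) ≡ 1 + (bit a + bit b + bit c ∸ 1)
    table true  true  true  = refl
    table true  true  false = refl
    table true  false true  = refl
    table true  false false = refl
    table false true  true  = refl
    table false true  false = refl
    table false false true  = refl
    table false false false = refl

  deg-cov : ∀ v → deg cov v ≡ 3
  deg-cov v = trans (deg-+ (λ e → χ A e + χ B e) (χ C) v) (cong₂ _+_ (trans (deg-+ (χ A) (χ B) v) (cong₂ _+_ (A-perfect v) (B-perfect v))) (C-perfect v))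

  -- Take degrees in `missed+cov`: both `cov` and the constant 1 have degree 3 at every vertex.
  balance : ∀ v → deg (χ U) v ≡ deg excess v
  balance v = +-cancelʳ-≡ 3 (deg (χ U) v) (deg excess v) (begin
    deg (χ U) v + 3                     ≡⟨ cong (deg (χ U) v +_) (sym (deg-cov v)) ⟩
    deg (χ U) v + deg cov v             ≡⟨ sym (deg-+ (χ U) cov v) ⟩
    deg (λ e → χ U e + cov e) v         ≡⟨ deg-cong missed+cov v ⟩
    deg (λ e → 1 + excess e) v          ≡⟨ deg-+ (λ _ → 1) excess v ⟩
    deg (λ _ → 1) v + deg excess v      ≡⟨ cong (_+ deg excess v) (cubic-deg v) ⟩
    3 + deg excess v                    ≡⟨ +-comm 3 (deg excess v) ⟩
    deg excess v + 3                    ∎)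
    where open ≡-Reasoning

  total-excess : sum excess ≡ 4
  total-excess = *-cancelˡ-≡ (sum excess) 4 2 (begin
    2 * sum excess                    ≡⟨ *-distribˡ-sum 2 excess ⟩
    sum (λ e → 2 * excess e)          ≡⟨ sum-cong-≗ (λ e → *-comm 2 (excess e)) ⟩
    sum (λ e → excess e * 2)          ≡⟨ sym (handshake excess (λ _ → 1)) ⟩
    sum (λ v → 1 * deg excess v)      ≡⟨ sum-cong-≗ (λ v → trans (*-identityˡ (deg excess v)) (sym (balance v))) ⟩
    sum (deg (χ U))                   ≡⟨ degree-sum U ⟩
    ∣ U ∣ * 2                         ≡⟨ cong (_* 2) ∣missed∣ ⟩
    8                                 ∎)
    where open ≡-Reasoning

  excess⇒2≤ : ∀ {e} → 1 ≤ excess e → 2 ≤ cov e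
  excess⇒2≤ {e} = two (cov e)
    where
    two : ∀ c → 1 ≤ c ∸ 1 → 2 ≤ c
    two (suc c) le = s≤s le

  triple⇒excess : ∀ {e} → cov e ≡ 3 → 1 ≤ excess e
  triple⇒excess ≡3 = ≤-trans (s≤s z≤n) (≤-reflexive (sym (cong (_∸ 1) ≡3)))

  missed⇒cov≡0 : ∀ {e} → U ∋ e → cov e ≡ 0
  missed⇒cov≡0 U∋e = cong₂ _+_ (cong₂ _+_ (χ-∌ (missed-∌ first U∋e)) (χ-∌ (missed-∌ second U∋e))) (χ-∌ (missed-∌ third U∋e))

  excess-∌ : ∀ {e} → 1 ≤ excess e → U ∌ e
  excess-∌ {e} le with ∋? U e
  ... | inj₂ p   = p
  ... | inj₁ U∋e = contradiction (≤-trans (excess⇒2≤ {e} le) (≤-reflexive (missed⇒cov≡0 U∋e))) λ ()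

  -- By `balance`; together with `missed-at` it lets a walk alternate between missed edges and edges
  -- of excess.
  excess-at : ∀ {a p} → U ∋ a → 1 ≤ inc a p → ∃[ h ] 1 ≤ excess h × 1 ≤ inc h p
  excess-at {a} {p} U∋a ap = deg-positive G excess p (≤-trans ap (≤-trans (inc≤deg U p U∋a) (≤-reflexive (balance p))))

  missed-at : ∀ {h p} → 1 ≤ excess h → 1 ≤ inc h p → ∃[ b ] U ∋ b × 1 ≤ inc b p
  missed-at {h} {p} h-excess hp = deg-witness U p (≤-trans (*-mono-≤ h-excess hp)
    (≤-trans (term≤sum (λ e → excess e * inc e p) h) (≤-reflexive (sym (balance p)))))

  -- Exchanges, and the exclusion of triply covered edges.

  -- The additive form avoids truncated subtraction.
  exchange₁ : ∀ {X g a} → X ∋ g → X ∌ a → ∀ v → deg (χ (X ⊖ g ⊕ a)) v + inc g v ≡ deg (χ X) v + inc a v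
  exchange₁ {X} {g} {a} X∋g X∌a v = begin
    deg (χ (X ⊖ g ⊕ a)) v + inc g v         ≡⟨ cong (_+ inc g v) (deg-⊕ (X ⊖ g) (trans (⊖-other X (∋-≢ {S = X} X∋g X∌a ∘ sym)) X∌a) v) ⟩
    deg (χ (X ⊖ g)) v + inc a v + inc g v   ≡⟨ xy∙z≈xz∙y (deg (χ (X ⊖ g)) v) (inc a v) (inc g v) ⟩
    deg (χ (X ⊖ g)) v + inc g v + inc a v   ≡⟨ cong (_+ inc a v) (sym (deg-⊖ X X∋g v)) ⟩
    deg (χ X) v + inc a v                   ∎
    where
    open ≡-Reasoning

  exchange-keeps : ∀ (X : EdgeSet) (g a e : Edge) → X ∌ a → X ∋ e → e ≡ g ⊎ X ⊖ g ⊕ a ∋ e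
  exchange-keeps X g a e X∌a X∋e with e ≟ g
  ... | yes e≡g = inj₁ e≡g
  ... | no  e≢g = inj₂ (trans (⊕-other (X ⊖ g) (∋-≢ {S = X} X∋e X∌a)) (trans (⊖-other X e≢g) X∋e))

  -- In a matching containing `g`, replacing it by the parallel edge `a` keeps the matching perfect.
  -- The edge `g` stays covered by another matching, so the defect would drop.
  no-parallel : ∀ {g a p q} → 1 ≤ excess g → U ∋ a → Joins g p q → Joins a p q → ⊥
  no-parallel {g} {a} g-excess U∋a jg ja with covering g (≤-trans (s≤s z≤n) (excess⇒2≤ {g} g-excess))
  ... | X , sel , X∋g = ∋-∌ (⊕-∋ (X ⊖ g) a) (replace-selected sel N N-perfect keep a U∋a)
    where
    X∌a : X ∌ a
    X∌a = missed-∌ sel U∋a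
    N = X ⊖ g ⊕ a
    N-perfect : Perfect N
    N-perfect v = +-cancelʳ-≡ (inc g v) _ 1 (trans (exchange₁ {X} X∋g X∌a v)
      (cong₂ _+_ (selected-perfect sel v) (trans (inc-joins ja v) (sym (inc-joins jg v)))))
    keep : ∀ e → X ∋ e → N ∋ e ⊎ 2 ≤ cov e
    keep e X∋e with exchange-keeps X g a e X∌a X∋e
    ... | inj₁ refl = inj₂ (excess⇒2≤ {g} g-excess)
    ... | inj₂ N∋e  = inj₁ N∋e

  -- The edges `a`, `h`, `z`, `g` form the 4-circuit `u x y v`. A matching containing `h` contains
  -- `g` too, as `g` lies in all three. Trading `g`, `h` for `a`, `z` uncovers nothing and covers
  -- missed edges.
  no-square : ∀ {g h a z u x y v} → cov g ≡ 3 → 1 ≤ excess h → g ≢ h → U ∋ a → U ∋ z → a ≢ z →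
              Joins g u v → Joins h x y → Joins a u x → Joins z v y → ⊥
  no-square {g} {h} {a} {z} {u} {x} {y} {v} g-triple h-excess g≢h U∋a U∋z a≢z jg jh ja jz
    with covering h (≤-trans (s≤s z≤n) (excess⇒2≤ {h} h-excess))
  ... | X , sel , X∋h = ∋-∌ (⊕-∋ (N₁ ⊖ h) z) (replace-selected sel N N-perfect keep z U∋z)
    where
    X∋g : X ∋ g
    X∋g = triple-∋ sel g-triple
    X∌a : X ∌ a
    X∌a = missed-∌ sel U∋a
    X∌z : X ∌ z
    X∌z = missed-∌ sel U∋z
    N₁ = X ⊖ g ⊕ a
    N  = N₁ ⊖ h ⊕ z
    other : ∀ {e} → e ≢ g → e ≢ a → lookup N₁ e ≡ lookup X e
    other e≢g e≢a = trans (⊕-other (X ⊖ g) e≢a) (⊖-other X e≢g)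
    N₁∋h : N₁ ∋ h
    N₁∋h = trans (other (g≢h ∘ sym) (∋-≢ {S = X} X∋h X∌a)) X∋h
    N₁∌z : N₁ ∌ z
    N₁∌z = trans (other (∋-≢ {S = X} X∋g X∌z ∘ sym) (a≢z ∘ sym)) X∌z
    N-perfect : Perfect N
    -- With incidences written as deltas of `u`, `v`, `x`, `y`, the two single exchanges become
    -- linear equations in which all four deltas cancel.
    N-perfect w = cancel (deg (χ N) w) (deg (χ N₁) w) (deg (χ X) w) (δ u w) (δ v w) (δ x w) (δ y w) (selected-perfect sel w)
      (substEnds (deg (χ N) w) (deg (χ N₁) w) (exchange₁ {N₁} {h} {z} N₁∋h N₁∌z w) (inc-joins jh w) (inc-joins jz w))
      (substEnds (deg (χ N₁) w) (deg (χ X) w) (exchange₁ {X} {g} {a} X∋g X∌a w) (inc-joins jg w) (inc-joins ja w))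
      where
      substEnds : ∀ m n {i j k l} → m + i ≡ n + j → i ≡ k → j ≡ l → m + k ≡ n + l
      substEnds m n p refl refl = p
      cancel : ∀ n₂ n₁ n₀ u v x y → n₀ ≡ 1 → n₂ + (x + y) ≡ n₁ + (v + y) → n₁ + (u + v) ≡ n₀ + (u + x) → n₂ ≡ 1
      cancel n₂ n₁ .1 u v x y refl e₁ e₂ = +-cancelʳ-≡ x n₂ 1 (trans
        (+-cancelʳ-≡ y (n₂ + x) (n₁ + v) (trans (+-assoc n₂ x y) (trans e₁ (sym (+-assoc n₁ v y)))))
        (+-cancelˡ-≡ u (n₁ + v) (1 + x) (trans (x∙yz≈y∙xz u n₁ v) (trans e₂ (x∙yz≈y∙xz 1 u x)))))
    keep : ∀ e → X ∋ e → N ∋ e ⊎ 2 ≤ cov e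
    keep e X∋e with exchange-keeps X g a e X∌a X∋e
    ... | inj₁ refl = inj₂ (excess⇒2≤ {g} (triple⇒excess {g} g-triple))
    ... | inj₂ N₁∋e with exchange-keeps N₁ h z e N₁∌z N₁∋e
    ...   | inj₁ refl = inj₂ (excess⇒2≤ {h} h-excess)
    ...   | inj₂ N∋e  = inj₁ N∋e

  covered : ∀ {e} → U ∌ e → 1 ≤ cov e
  covered {e} U∌e = ≤-trans (≤-trans (s≤s z≤n) (≤-reflexive (sym (missed+cov e)))) (≤-reflexive (cong (_+ cov e) (χ-∌ U∌e)))

  -- A matching covering `e` would also contain `g` and so have two edges at `w`.
  triple-neighbour : ∀ {g e w} → cov g ≡ 3 → e ≢ g → 1 ≤ inc g w → 1 ≤ inc e w → U ∋ e
  triple-neighbour {g} {e} {w} g-triple e≢g gw ew with ∋? U e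
  ... | inj₁ U∋e = U∋e
  ... | inj₂ U∌e with covering e (covered U∌e)
  ...   | X , sel , X∋e = contradiction (≤-trans (+-mono-≤ ew gw) (≤-trans (two-at X w X∋e (triple-∋ sel g-triple) e≢g) (≤-reflexive (selected-perfect sel w)))) λ { (s≤s ()) }

  -- The excess 2 of `g` has to be balanced by missed edges at each of its ends.
  triple-deg : ∀ {g w} → cov g ≡ 3 → 1 ≤ inc g w → 2 ≤ deg (χ U) w
  triple-deg {g} {w} g-triple gw = ≤-trans (*-mono-≤ {2} {excess g} {1} {inc g w} (≤-reflexive (sym (cong (_∸ 1) g-triple))) gw)
    (≤-trans (term≤sum (λ e → excess e * inc e w) g) (≤-reflexive (sym (balance w))))

  MissedPair : Vertex → Set
  MissedPair w = ∃[ a ] ∃[ b ] U ∋ a × U ∋ b × a ≢ b × 1 ≤ inc a w × 1 ≤ inc b w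

  two-missed : ∀ {w} → 2 ≤ deg (χ U) w → MissedPair w
  two-missed {w} two with deg-witness U w (≤-trans (s≤s z≤n) two)
  -- As `a` is not a loop, it accounts for only one of the two units of degree.
  ... | a , U∋a , aw with deg-witness (U ⊖ a) w (+-cancelʳ-≤ 1 1 _ (≤-trans two (≤-trans (≤-reflexive (deg-⊖ U U∋a w)) (+-monoʳ-≤ (deg (χ (U ⊖ a)) w) (inc≤1 a w)))))
  ...   | b , U⊖a∋b , bw with ⊖-∋⁻ U U⊖a∋b
  ...     | a≢b , U∋b = a , b , U∋a , U∋b , a≢b , aw , bw

  -- If g = uv were in all three matchings, the two missed edges at u and the
  -- two at v would be all the missed edges.  A walk u, x, y along a missed edge
  -- and an edge of excess then continues by a missed edge either to v, and
  -- exchanging the square u x y v in one matching covers more edges, or back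
  -- to u, which gives a triangle.
  no-triple : ∀ g → cov g ≢ 3
  no-triple g g-triple = walk-from (two-missed (triple-deg g-triple (inc-src g))) (two-missed (triple-deg g-triple (inc-tgt g)))
    where
    walk-from : MissedPair (src g) → MissedPair (tgt g) → ⊥
    walk-from (a , b , U∋a , U∋b , a≢b , au , bu) (c , d , U∋c , U∋d , c≢d , cv , dv) = walk
      where
      u v : Vertex
      u = src g
      v = tgt g
      u≢v : u ≢ v
      u≢v = no-loop g
      jg : Joins g u v
      jg = joining (inc≡ g)
      g-excess : 1 ≤ excess g
      g-excess = triple⇒excess {g} g-triple
      no-both : ∀ {e} → U ∋ e → 1 ≤ inc e u → 1 ≤ inc e v → ⊥
      no-both {e} U∋e eu ev = no-parallel {g} {e} g-excess U∋e jg (joins {e} eu ev u≢v)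
      apart : ∀ {e f} → U ∋ e → 1 ≤ inc e u → 1 ≤ inc f v → e ≢ f
      apart U∋e eu fv refl = no-both U∋e eu fv
      all-missed : ∀ {z} → U ∋ z → z List.∈ (a ∷ b ∷ c ∷ d ∷ [])
      all-missed = unique-exhausts U (a ∷ b ∷ c ∷ d ∷ [])
        ((a≢b ∷ apart U∋a au cv ∷ apart U∋a au dv ∷ []) ∷ (apart U∋b bu cv ∷ apart U∋b bu dv ∷ []) ∷ (c≢d ∷ []) ∷ [] ∷ [])
        (U∋a ∷ U∋b ∷ U∋c ∷ U∋d ∷ []) (≤-reflexive ∣missed∣)
      walk : ⊥
      walk with other-end {a} {u} au
      ... | x , u≢x , ja with excess-at {a} {x} U∋a (joins-right ja)
      ...   | h , h-excess , hx with other-end {h} {x} hx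
      ...     | y , x≢y , jh with missed-at {h} {y} h-excess (joins-right jh)
      ...       | z , U∋z , zy = close (all-missed U∋z)
        where
        x≢v : x ≢ v
        x≢v refl = no-both U∋a au (joins-right ja)
        g≢h : g ≢ h
        g≢h refl with joins-only jg hx
        ... | inj₁ x≡u = u≢x (sym x≡u)
        ... | inj₂ x≡v = x≢v x≡v
        -- Any edge other than `g` at an end of `g` is missed, whereas `h` has excess.
        not-at : ∀ {w} → 1 ≤ inc g w → w ≢ y
        not-at gw refl = ∋-∌ (triple-neighbour {g} {h} g-triple (g≢h ∘ sym) gw (joins-right jh)) (excess-∌ {h} h-excess)
        u≢y : u ≢ y
        u≢y = not-at (inc-src g)
        v≢y : v ≢ y
        v≢y = not-at (inc-tgt g)
        jh′ : Joins h y x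
        jh′ = joins (joins-right jh) (joins-left jh) (x≢y ∘ sym)
        square : ∀ {e} → U ∋ e → 1 ≤ inc e v → 1 ≤ inc e y → ⊥
        square {e} U∋e ev ey = no-square g-triple h-excess g≢h U∋a U∋e (apart U∋a au ev) jg jh ja (joins {e} ev ey v≢y)
        triangle : Joins b u y → ⊥
        triangle jb with other-end {c} {v} cv
        -- Besides `v`, the far end `w` of `c` lies off the triangle: at `u` it would make `c`
        -- parallel to `g`, and at `x` or `y` it would close a square with `g`, `h` and `b` or `a`.
        ... | w , v≢w , jc = no-triangle u≢x u≢y x≢y ja jb jh (u≢v ∘ sym) (x≢v ∘ sym) v≢y
                               (λ { refl → no-both U∋c (joins-right jc) cv })
                               (λ { refl → no-square g-triple h-excess g≢h U∋b U∋c (apart U∋b bu cv) jg jh′ jb jc })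
                               (λ { refl → square U∋c cv (joins-right jc) })
                               v≢w
        close : z List.∈ (a ∷ b ∷ c ∷ d ∷ []) → ⊥
        close (here refl) with joins-only ja zy
        ... | inj₁ y≡u = u≢y (sym y≡u)
        ... | inj₂ y≡x = x≢y (sym y≡x)
        close (there (here refl))                 = triangle (joins bu zy u≢y)
        close (there (there (here refl)))         = square U∋c cv zy
        close (there (there (there (here refl)))) = square U∋d dv zy

  -- Without triply covered edges, `cov` plus twice `χ U` is at most 2 on every edge. Summing at `w`
  -- bounds 3 plus twice the missed degree by 6.
  missed-deg≤1 : ∀ w → deg (χ U) w ≤ 1
  missed-deg≤1 w = halve (deg (χ U) w) (≤-trans (≤-reflexive (sym total)) (≤-trans (sum-mono λ e → *-monoˡ-≤ (inc e w) (bound e)) (≤-reflexive six)))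
    where
    total : deg (λ e → cov e + (χ U e + χ U e)) w ≡ 3 + (deg (χ U) w + deg (χ U) w)
    total = trans (deg-+ cov (λ e → χ U e + χ U e) w) (cong₂ _+_ (deg-cov w) (deg-+ (χ U) (χ U) w))
    six : deg (λ _ → 2) w ≡ 6
    six = trans (deg-+ (λ _ → 1) (λ _ → 1) w) (cong₂ _+_ (cubic-deg w) (cubic-deg w))
    bound : ∀ e → cov e + (χ U e + χ U e) ≤ 2
    bound e with ∋? U e
    ... | inj₁ U∋e = ≤-reflexive (cong₂ _+_ (missed⇒cov≡0 U∋e) (cong₂ _+_ (χ-∋ U∋e) (χ-∋ U∋e)))
    ... | inj₂ U∌e = ≤-trans (+-mono-≤ (≤-pred (≤∧≢⇒< (+-mono-≤ (+-mono-≤ (χ≤1 A e) (χ≤1 B e)) (χ≤1 C e)) (no-triple e)))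
                                       (≤-reflexive (cong₂ _+_ (χ-∌ U∌e) (χ-∌ U∌e)))) ≤-refl
    halve : ∀ k → 3 + (k + k) ≤ 6 → k ≤ 1
    halve zero          _ = z≤n
    halve (suc zero)    _ = ≤-refl
    halve (suc (suc k)) (s≤s (s≤s (s≤s (s≤s (s≤s le))))) = contradiction (≤-trans (≤-trans (s≤s (s≤s z≤n)) (m≤n+m (suc (suc k)) k)) le) λ { (s≤s ()) }

  missed-disjoint : ∀ {a b} → U ∋ a → U ∋ b → a ≢ b → ∀ w → inc a w + inc b w ≤ 1
  missed-disjoint U∋a U∋b a≢b w = ≤-trans (two-at U w U∋a U∋b a≢b) (missed-deg≤1 w)

  same-end : ∀ {a b w} → U ∋ a → U ∋ b → 1 ≤ inc a w → 1 ≤ inc b w → a ≡ b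
  same-end {a} {b} {w} U∋a U∋b aw bw with a ≟ b
  ... | yes a≡b = a≡b
  ... | no  a≢b = contradiction (≤-trans (+-mono-≤ aw bw) (missed-disjoint U∋a U∋b a≢b w)) λ { (s≤s ()) }

  -- Covering the missed edges in two pairs.

  Covered : Edge → Edge → Set
  Covered a b = ∃[ N ] Perfect N × N ∋ a × N ∋ b

  covered-sym : ∀ {a b} → Covered a b → Covered b a
  covered-sym (N , perfect , N∋a , N∋b) = N , perfect , N∋b , N∋a

  -- Some matching of the triple avoids `h` by `no-triple`, and it avoids the missed edges `a` and
  -- `b`, so `extension` applies to the path `a`, `h`, `b`.
  pair-covered : ∀ {a b h p q} → U ∋ a → U ∋ b → a ≢ b → 1 ≤ excess h → Joins h p q → 1 ≤ inc a p → 1 ≤ inc b q → Covered a b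
  pair-covered {a} {b} {h} U∋a U∋b a≢b h-excess jh ap bq = through (avoiding h (no-triple h))
    where
    off : ∀ {e} → U ∋ e → e ≢ h
    off U∋e refl = ∋-∌ U∋e (excess-∌ {h} h-excess)
    at-end : ∀ w → 1 ≤ inc h w → 1 ≤ inc a w + inc b w
    at-end w hw with joins-only jh hw
    ... | inj₁ refl = ≤-trans ap (m≤m+n _ _)
    ... | inj₂ refl = ≤-trans bq (m≤n+m _ (inc a w))
    through : ∃[ X ] Selected X × X ∌ h → Covered a b
    through (X , sel , X∌h) = PathExtension.extension G cubic connected {X} (selected-perfect sel) a h b
      (missed-disjoint U∋a U∋b a≢b) at-end (off U∋a) (off U∋b) (missed-∌ sel U∋a) X∌h (missed-∌ sel U∋b)

  -- Follows an edge of excess from `p` to a missed edge at its far end. That edge is not `a`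
  -- itself, by `no-parallel`.
  partner : ∀ {a p} → U ∋ a → 1 ≤ inc a p → ∃[ h ] ∃[ q ] ∃[ b ] 1 ≤ excess h × Joins h p q × U ∋ b × 1 ≤ inc b q × a ≢ b
  partner {a} {p} U∋a ap with excess-at {a} {p} U∋a ap
  ... | h , h-excess , hp with other-end {h} {p} hp
  ... | q , p≢q , jh with missed-at {h} {q} h-excess (joins-right jh)
  ... | b , U∋b , bq = h , q , b , h-excess , jh , U∋b , bq , λ { refl → no-parallel {h} {a} h-excess U∋a jh (joins {a} ap bq p≢q) }

  -- Each listed edge uses at least one unit of the total excess 4.
  excess-count : ∀ hs → Unique hs → All (λ h → 1 ≤ excess h) hs → length hs ≤ 4
  excess-count hs uniq all = ≤-trans (unique-length S hs uniq (All.map (filter⁺ excess?) all))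
    (≤-trans (≤-reflexive (∣∣≡sum S)) (≤-trans (sum-mono λ e → le e (∋? S e)) (≤-reflexive total-excess)))
    where
    excess? : ∀ e → Dec (1 ≤ excess e)
    excess? e = 1 ≤? excess e
    S : EdgeSet
    S = filter excess?
    le : ∀ e → S ∋ e ⊎ S ∌ e → χ S e ≤ excess e
    le e (inj₁ S∋e) = ≤-trans (χ≤1 S e) (filter⁻ excess? S∋e)
    le e (inj₂ S∌e) = ≤-trans (≤-reflexive (χ-∌ S∌e)) z≤n

  -- If no edge of excess joined c and d, the four such edges at the ends of
  -- c and d together with h would exceed the total excess 4.
  module Pairing {a b c d h p q}
    (U∋a : U ∋ a) (U∋b : U ∋ b) (U∋c : U ∋ c) (U∋d : U ∋ d)
    (a≢b : a ≢ b) (a≢c : a ≢ c) (a≢d : a ≢ d) (b≢c : b ≢ c) (b≢d : b ≢ d) (c≢d : c ≢ d)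
    (h-excess : 1 ≤ excess h) (jh : Joins h p q) (ap : 1 ≤ inc a p) (bq : 1 ≤ inc b q) where

    all-missed : ∀ {z} → U ∋ z → z List.∈ (a ∷ b ∷ c ∷ d ∷ [])
    all-missed = unique-exhausts U (a ∷ b ∷ c ∷ d ∷ [])
      ((a≢b ∷ a≢c ∷ a≢d ∷ []) ∷ (b≢c ∷ b≢d ∷ []) ∷ (c≢d ∷ []) ∷ [] ∷ [])
      (U∋a ∷ U∋b ∷ U∋c ∷ U∋d ∷ []) (≤-reflexive ∣missed∣)

    EndOf : Edge → Edge → Vertex → Set
    EndOf e f w = 1 ≤ inc e w ⊎ 1 ≤ inc f w

    separate : ∀ {w} → EndOf a b w → ¬ EndOf c d w
    separate {w} (inj₁ aw) (inj₁ cw) = a≢c (same-end {w = w} U∋a U∋c aw cw)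
    separate {w} (inj₁ aw) (inj₂ dw) = a≢d (same-end {w = w} U∋a U∋d aw dw)
    separate {w} (inj₂ bw) (inj₁ cw) = b≢c (same-end {w = w} U∋b U∋c bw cw)
    separate {w} (inj₂ bw) (inj₂ dw) = b≢d (same-end {w = w} U∋b U∋d bw dw)

    Crossing : Vertex → Set
    Crossing w = ∃[ k ] ∃[ w′ ] 1 ≤ excess k × Joins k w w′ × EndOf a b w′

    -- The partner of `c` at `w` is `d`, which yields the desired matching, or one of `a`, `b`,
    -- which yields a crossing.
    probe-c : ∀ {w} → 1 ≤ inc c w → Covered c d ⊎ Crossing w
    probe-c {w} cw = let k , w′ , s , k-excess , jk , U∋s , sw′ , c≢s = partner {c} {w} U∋c cw in
                     partner-in (all-missed U∋s) k-excess jk sw′ c≢s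
      where
      partner-in : ∀ {k w′ s} → s List.∈ (a ∷ b ∷ c ∷ d ∷ []) → 1 ≤ excess k → Joins k w w′ → 1 ≤ inc s w′ → c ≢ s → Covered c d ⊎ Crossing w
      partner-in (here refl)                         k-excess jk sw′ _ = inj₂ (_ , _ , k-excess , jk , inj₁ sw′)
      partner-in (there (here refl))                 k-excess jk sw′ _ = inj₂ (_ , _ , k-excess , jk , inj₂ sw′)
      partner-in (there (there (here refl)))         k-excess jk sw′ c≢s = contradiction refl c≢s
      partner-in (there (there (there (here refl)))) k-excess jk sw′ c≢s = inj₁ (pair-covered U∋c U∋d c≢d k-excess jk cw sw′)

    probe-d : ∀ {w} → 1 ≤ inc d w → Covered c d ⊎ Crossing w
    probe-d {w} dw = let k , w′ , s , k-excess , jk , U∋s , sw′ , d≢s = partner {d} {w} U∋d dw in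
                     partner-in (all-missed U∋s) k-excess jk sw′ d≢s
      where
      partner-in : ∀ {k w′ s} → s List.∈ (a ∷ b ∷ c ∷ d ∷ []) → 1 ≤ excess k → Joins k w w′ → 1 ≤ inc s w′ → d ≢ s → Covered c d ⊎ Crossing w
      partner-in (here refl)                         k-excess jk sw′ _ = inj₂ (_ , _ , k-excess , jk , inj₁ sw′)
      partner-in (there (here refl))                 k-excess jk sw′ _ = inj₂ (_ , _ , k-excess , jk , inj₂ sw′)
      partner-in (there (there (here refl)))         k-excess jk sw′ d≢s = inj₁ (covered-sym (pair-covered U∋d U∋c (c≢d ∘ sym) k-excess jk dw sw′))
      partner-in (there (there (there (here refl)))) k-excess jk sw′ d≢s = contradiction refl d≢s

    -- Both ends of `h` belong to `a` or `b`, but a crossing starts at an end of `c` or `d`.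
    h≢ : ∀ {w} → EndOf c d w → (k : Crossing w) → h ≢ proj₁ k
    h≢ w∈ (k , w′ , _ , jk , _) refl with joins-only jh (joins-left jk)
    ... | inj₁ refl = separate (inj₁ ap) w∈
    ... | inj₂ refl = separate (inj₂ bq) w∈

    -- The far end of a crossing lies on `a` or `b`, so one edge cannot start crossings at two
    -- different ends of `c` and `d`.
    crossing≢ : ∀ {w x} → w ≢ x → EndOf c d x → (k : Crossing w) (l : Crossing x) → proj₁ k ≢ proj₁ l
    crossing≢ w≢x x∈ (k , w′ , _ , jk , w′∈) (.k , x′ , _ , jl , _) refl with joins-only jk (joins-left jl)
    ... | inj₁ x≡w  = w≢x (sym x≡w)
    ... | inj₂ refl = separate w′∈ x∈

    cd-covered : Covered c d
    cd-covered = collect (probe-c (inc-src c)) (probe-c (inc-tgt c)) (probe-d (inc-src d)) (probe-d (inc-tgt d))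
      where
      c₁ : EndOf c d (src c)
      c₁ = inj₁ (inc-src c)
      c₂ : EndOf c d (tgt c)
      c₂ = inj₁ (inc-tgt c)
      d₁ : EndOf c d (src d)
      d₁ = inj₂ (inc-src d)
      d₂ : EndOf c d (tgt d)
      d₂ = inj₂ (inc-tgt d)
      c-d : ∀ {w x} → 1 ≤ inc c w → 1 ≤ inc d x → w ≢ x
      c-d {w} cw dx refl = c≢d (same-end {w = w} U∋c U∋d cw dx)
      excessive : ∀ {w} (k : Crossing w) → 1 ≤ excess (proj₁ k)
      excessive k = proj₁ (proj₂ (proj₂ k))
      collect : Covered c d ⊎ Crossing (src c) → Covered c d ⊎ Crossing (tgt c) → Covered c d ⊎ Crossing (src d) → Covered c d ⊎ Crossing (tgt d) → Covered c d
      collect (inj₁ done) _ _ _ = done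
      collect (inj₂ _) (inj₁ done) _ _ = done
      collect (inj₂ _) (inj₂ _) (inj₁ done) _ = done
      collect (inj₂ _) (inj₂ _) (inj₂ _) (inj₁ done) = done
      collect (inj₂ k₁) (inj₂ k₂) (inj₂ k₃) (inj₂ k₄) = contradiction
        (excess-count (h ∷ proj₁ k₁ ∷ proj₁ k₂ ∷ proj₁ k₃ ∷ proj₁ k₄ ∷ [])
          ( (h≢ c₁ k₁ ∷ h≢ c₂ k₂ ∷ h≢ d₁ k₃ ∷ h≢ d₂ k₄ ∷ [])
          ∷ (crossing≢ (no-loop c) c₂ k₁ k₂ ∷ crossing≢ (c-d (inc-src c) (inc-src d)) d₁ k₁ k₃ ∷ crossing≢ (c-d (inc-src c) (inc-tgt d)) d₂ k₁ k₄ ∷ [])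
          ∷ (crossing≢ (c-d (inc-tgt c) (inc-src d)) d₁ k₂ k₃ ∷ crossing≢ (c-d (inc-tgt c) (inc-tgt d)) d₂ k₂ k₄ ∷ [])
          ∷ (crossing≢ (no-loop d) d₂ k₃ k₄ ∷ []) ∷ [] ∷ [])
          (h-excess ∷ excessive k₁ ∷ excessive k₂ ∷ excessive k₃ ∷ excessive k₄ ∷ []))
        1+n≰n

  MissedCovered : Set
  MissedCovered = ∃[ N ] ∃[ N′ ] Perfect N × Perfect N′ × (∀ {e} → U ∋ e → N ∋ e ⊎ N′ ∋ e)

  cover-pairs : ∀ {a b c d} → (∀ {e} → U ∋ e → e List.∈ (a ∷ b ∷ c ∷ d ∷ [])) → Covered a b → Covered c d → MissedCovered
  cover-pairs {a} {b} {c} {d} all (N , N-perfect , N∋a , N∋b) (N′ , N′-perfect , N′∋c , N′∋d) =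
    N , N′ , N-perfect , N′-perfect , λ U∋e → split (all U∋e)
    where
    split : ∀ {e} → e List.∈ (a ∷ b ∷ c ∷ d ∷ []) → N ∋ e ⊎ N′ ∋ e
    split (here refl)                         = inj₁ N∋a
    split (there (here refl))                 = inj₁ N∋b
    split (there (there (here refl)))         = inj₂ N′∋c
    split (there (there (there (here refl)))) = inj₂ N′∋d

  missed-covered : MissedCovered
  missed-covered = start (∃-∋ U (≤-trans (s≤s z≤n) (≤-reflexive (sym ∣missed∣))))
    where
    complete : ∀ {a b h p q} → U ∋ a → U ∋ b → a ≢ b → 1 ≤ excess h → Joins h p q → 1 ≤ inc a p → 1 ≤ inc b q → TwoMore U a b → MissedCovered
    complete U∋a U∋b a≢b h-excess jh ap bq (c , d , (U∋c , U∋d) , (a≢c , a≢d) , (b≢c , b≢d) , c≢d) =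
      cover-pairs all-missed (pair-covered U∋a U∋b a≢b h-excess jh ap bq) cd-covered
      where open Pairing U∋a U∋b U∋c U∋d a≢b a≢c a≢d b≢c b≢d c≢d h-excess jh ap bq using (all-missed; cd-covered)
    joined : ∀ {a} → U ∋ a → (∃[ h ] ∃[ q ] ∃[ b ] 1 ≤ excess h × Joins h (src a) q × U ∋ b × 1 ≤ inc b q × a ≢ b) → MissedCovered
    joined {a} U∋a (h , q , b , h-excess , jh , U∋b , bq , a≢b) =
      complete U∋a U∋b a≢b h-excess jh (inc-src a) bq (two-more U ∣missed∣ U∋a U∋b a≢b)
    start : ∃[ a ] U ∋ a → MissedCovered
    start (a , U∋a) = joined U∋a (partner {a} {src a} U∋a (inc-src a))

-- Assembling the Berge cover.

theorem5p3 : (G : Graph) → Cubic G → CyclicallyEdgeConnected G 4 → ColouringDefect G 4 → ∃[ Ms ] BergeCover G Ms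
theorem5p3 G cubic connected ((A , B , C , A-matching , B-matching , C-matching , missed≡4) , minimal) =
  conclude (Defect.missed-covered G cubic connected A B C (toPerfect {A} A-matching) (toPerfect {B} B-matching) (toPerfect {C} C-matching) optimal
             (trans (cong ∣_∣ (missed≡ A B C)) missed≡4))
  where
  open Graph G
  open Incidence G
  open Extension G cubic connected using (Perfect)
  open Triple G cubic connected using (missed; missed≡; missed⁺)
  toPerfect : ∀ {M} → IsPerfectMatching G M → Perfect M
  toPerfect {M} matching v = trans (sym (degree≡deg M v)) (matching v)
  fromPerfect : ∀ {M} → Perfect M → IsPerfectMatching G M
  fromPerfect {M} perfect v = trans (degree≡deg M v) (perfect v)
  optimal : ∀ A′ B′ C′ → Perfect A′ → Perfect B′ → Perfect C′ → ∣ missed A B C ∣ ≤ ∣ missed A′ B′ C′ ∣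
  optimal A′ B′ C′ p q r = ≤-trans (≤-reflexive (trans (cong ∣_∣ (missed≡ A B C)) missed≡4))
    (≤-trans (minimal A′ B′ C′ (fromPerfect {A′} p) (fromPerfect {B′} q) (fromPerfect {C′} r)) (≤-reflexive (cong ∣_∣ (sym (missed≡ A′ B′ C′)))))
  conclude : ∃[ N ] ∃[ N′ ] Perfect N × Perfect N′ × (∀ {e} → missed A B C ∋ e → N ∋ e ⊎ N′ ∋ e) → ∃[ Ms ] BergeCover G Ms
  conclude (N , N′ , N-perfect , N′-perfect , missed-in) =
    A ∷ B ∷ C ∷ N ∷ N′ ∷ [] , ≤-refl , A-matching ∷ B-matching ∷ C-matching ∷ fromPerfect {N} N-perfect ∷ fromPerfect {N′} N′-perfect ∷ [] , cover
    where
    cover : ∀ e → Any (e ∈_) (A ∷ B ∷ C ∷ N ∷ N′ ∷ [])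
    cover e with ∋? A e | ∋? B e | ∋? C e
    ... | inj₁ A∋e | _ | _ = here (∋⇒∈ A∋e)
    ... | inj₂ _ | inj₁ B∋e | _ = there (here (∋⇒∈ B∋e))
    ... | inj₂ _ | inj₂ _ | inj₁ C∋e = there (there (here (∋⇒∈ C∋e)))
    ... | inj₂ A∌e | inj₂ B∌e | inj₂ C∌e with missed-in (missed⁺ A B C A∌e B∌e C∌e)
    ...   | inj₁ N∋e  = there (there (there (here (∋⇒∈ N∋e))))
    ...   | inj₂ N′∋e = there (there (there (there (here (∋⇒∈ N′∋e)))))
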